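{- $g(3)=g(4)=4$, where $g(k)$ denotes the minimal number of distinct $k$-abelian-squares that an infinite binary word must contain.
   Context: For finite words $u,w$, $|u|_w$ denotes the number of occurrences of $w$ as a factor of $u$. For $k\ge 1$, two finite words $u,v$ are $k$-abelian equivalent if $|u|_w=|v|_w$ for every non-empty word $w$ with $|w|\le k$. A $k$-abelian-square is a non-empty word $u_1u_2$ with $u_1$ and $u_2$ $k$-abelian equivalent. For an infinite word $x$ over $\{0,1\}$, consider the number (possibly infinite) of distinct finite words that are $k$-abelian-squares and occur as factors of $x$; $g(k)$ is the minimum of this number over all infinite words $x$ over $\{0,1\}$. -}

module Defs where

open import Data.Fin using (Fin; _≟_)
open import Data.List using (List; []; _++_; length; filter; tails; applyUpTo)
open import Data.List.Membership.Propositional using (_∈_)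
open import Data.List.Relation.Binary.Prefix.Heterogeneous.Properties using (prefix?)
open import Data.List.Relation.Unary.All using (All)
open import Data.List.Relation.Unary.Unique.Propositional using (Unique)
open import Data.Nat using (ℕ; _+_; _≤_)
open import Data.Product using (∃-syntax; _×_)
open import Function.Bundles using (_⇔_)
open import Relation.Binary.PropositionalEquality using (_≡_; _≢_)

Word : Set
Word = List (Fin 2)

InfWord : Set
InfWord = ℕ → Fin 2

-- Each occurrence of a non-empty w in u is identified with the suffix of u
-- that starts at that occurrence; overlapping occurrences are all counted.
∣_∣[_] : Word → Word → ℕ
∣ u ∣[ w ] = length (filter (prefix? _≟_ w) (tails u))

KAbelianEquivalent : ℕ → Word → Word → Set
KAbelianEquivalent k u v =
  ∀ (w : Word) → w ≢ [] → length w ≤ k → ∣ u ∣[ w ] ≡ ∣ v ∣[ w ]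

KAbelianSquare : ℕ → Word → Set
KAbelianSquare k s =
  s ≢ [] × ∃[ u₁ ] ∃[ u₂ ] (s ≡ u₁ ++ u₂ × KAbelianEquivalent k u₁ u₂)

_FactorOf_ : Word → InfWord → Set
w FactorOf x = ∃[ i ] w ≡ applyUpTo (λ j → x (i + j)) (length w)

KAbelianSquareIn : ℕ → InfWord → Word → Set
KAbelianSquareIn k x s = KAbelianSquare k s × s FactorOf x

-- Cardinality of a set of words, given as a predicate.  The set may be
-- infinite, so its cardinality is described by two relations rather than
-- computed as a natural number.
HasExactly : ℕ → (Word → Set) → Set
HasExactly n P =
  ∃[ ws ] (length ws ≡ n × Unique ws × (∀ w → w ∈ ws ⇔ P w))

HasAtLeast : ℕ → (Word → Set) → Set
HasAtLeast n P = ∃[ ws ] (length ws ≡ n × Unique ws × All P ws)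

-- g k ⩵ n says that the minimum g(k) exists and equals n: the value n is
-- attained by some infinite word and is a lower bound for every infinite word
-- (including those containing infinitely many k-abelian-squares).  It is a
-- relation because g is a minimum over an infinite family, for which there is
-- no a priori computable function.  Meaningful for k ≥ 1.
g_⩵_ : ℕ → ℕ → Set
g k ⩵ n =
  (∃[ x ] HasExactly n (KAbelianSquareIn k x)) ×
  (∀ (x : InfWord) → HasAtLeast n (KAbelianSquareIn k x))

{-# OPTIONS --safe #-}
module Submission where

open import Data.Bool using (Bool; true; false; _∧_; _∨_; not; if_then_else_)
open import Data.Bool.ListAction using (all; any)
open import Data.Bool.Properties using (T-≡)
open import Data.Fin as Fin using (Fin; zero; suc)
import Data.Fin.Properties as Fin
open import Data.Integer as ℤ using (ℤ; +_; -[1+_]; 0ℤ; 1ℤ)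
import Data.Integer.DivMod as ℤ
import Data.Integer.Properties as ℤ
open import Data.Integer.Tactic.RingSolver using (solve-∀)
open import Data.List using (List; []; _∷_; _++_; length; map; take; drop; applyUpTo; upTo; foldr)
open import Data.List.Properties
  using (length-++; length-applyUpTo; map-upTo; take++drop≡id; ∷-injectiveˡ; ∷-injectiveʳ)
open import Data.List.Membership.Propositional using (_∈_)
open import Data.List.Membership.Propositional.Properties using (∈-map⁺; ∈-++⁺ˡ; ∈-++⁺ʳ; ∈-upTo⁺; ∈-upTo⁻)
open import Data.List.Relation.Binary.Prefix.Heterogeneous.Properties using (prefix?)
open import Data.List.Relation.Unary.All as All using (All; []; _∷_)
open import Data.List.Relation.Unary.AllPairs using ([]; _∷_)
open import Data.List.Relation.Unary.Any using (here; there)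
open import Data.List.Relation.Unary.Unique.Propositional using (Unique)
open import Data.Nat
open import Data.Nat.DivMod
open import Data.Nat.Induction using (<-rec)
open import Data.Nat.Properties
import Data.Nat.Tactic.RingSolver as ℕ
open import Data.Product using (_×_; _,_; proj₁; proj₂; ∃-syntax)
open import Data.Sum using (_⊎_; inj₁; inj₂)
open import Function using (_∘_; it)
open import Function.Bundles using (Equivalence; mk⇔)
open import Relation.Binary.Definitions using (Tri; tri<; tri≈; tri>)
open import Relation.Binary.PropositionalEquality
open import Relation.Nullary using (¬_; contradiction; does)
open import Defs

-- Lower bound: every binary word of length 95 contains four distinct
-- 4-abelian-squares.  This is found by exhaustive search; the squares that the
-- search needs are stored in a trie of reversed words, so that all squares
-- ending at the last letter are read off in one walk.
--
-- Upper bound: a is the fixed point of a 16-uniform cyclic substitution on five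
-- letters, and y its image under a uniform binary substitution.  Write the three
-- cut points of a hypothetical square as q L + r.  The equality of weighted letter
-- (or factor) counts determines V(q₁) + V(q₃) − 2 V(q₂) from the r's and the
-- letters at the q's, where V counts letters: weights are chosen such that a block
-- contributes d times a unit vector, so congruences modulo d exclude almost all
-- cases.  In the remaining ones either moving some qᵢ by one yields an abelian
-- square of a, hence a contradiction by descent, or the triple is an instance of
-- one of finitely many templates (letters at the q's and value of V(q₁) + V(q₃) −
-- 2 V(q₂)), which are refuted by the same descent.

-- Every 4-abelian-square is a 3-abelian-square, so one lower bound, proved for `k = 4`, and one
-- upper bound, proved for `k = 3`, settle both values. The squares of `y` are 00, 11, 0101 and
-- 1010; being ordinary squares, they are `k`-abelian-squares for every `k`. Halves of length at
-- least 3 are 3-abelian equivalent only if they have the same numbers of factors of length 3, the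
-- same first two letters and the same last two letters. The counts are linear, but factors of
-- length 3 straddle the middle of the square, so that the middle cut point enters at two positions
-- at distance 2. The offset `k` of `Level` records this. All images of letters in `y` begin with
-- the same 12 letters; hence a sum that runs slightly past the end of a block still depends on one
-- letter of `a` only. The weights come from inverses of count matrices, scaled by a common
-- denominator `d`: they turn equality of counts into a formula for `d` times the second difference
-- of `V`. Non-integral values are thereby excluded at once. What remains need not vanish, because a
-- cut point may lie deep inside a block; this is why shifts and templates are needed besides plain
-- descent.

∧-split : ∀ {a b} → a ∧ b ≡ true → a ≡ true × b ≡ true
∧-split {true} {true} _ = refl , refl

≡ᵇ-sound : ∀ {m n} → (m ≡ᵇ n) ≡ true → m ≡ n
≡ᵇ-sound {m} {n} e = ≡ᵇ⇒≡ m n (Equivalence.from T-≡ e)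

all-sound : ∀ {A : Set} (p : A → Bool) xs → all p xs ≡ true → ∀ {x} → x ∈ xs → p x ≡ true
all-sound p (x ∷ xs) e (here refl) = proj₁ (∧-split e)
all-sound p (x ∷ xs) e (there x∈) = all-sound p xs (proj₂ (∧-split {p x} e)) x∈

-- Testing for k-abelian-squares

wordsUpTo : ℕ → List Word
wordsUpTo zero    = [] ∷ []
wordsUpTo (suc k) = [] ∷ map (zero ∷_) (wordsUpTo k) ++ map (suc zero ∷_) (wordsUpTo k)

∈-wordsUpTo : ∀ k w → length w ≤ k → w ∈ wordsUpTo k
∈-wordsUpTo zero    []               _        = here refl
∈-wordsUpTo (suc k) []               _        = here refl
∈-wordsUpTo (suc k) (zero ∷ w)       (s≤s le) =
  there (∈-++⁺ˡ (∈-map⁺ (zero ∷_) (∈-wordsUpTo k w le)))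
∈-wordsUpTo (suc k) (suc zero ∷ w)   (s≤s le) =
  there (∈-++⁺ʳ (map (zero ∷_) (wordsUpTo k)) (∈-map⁺ (suc zero ∷_) (∈-wordsUpTo k w le)))

-- The list also contains the empty word, whose count is the length plus one, so comparing it
-- compares lengths.
equivalent? : ℕ → Word → Word → Bool
equivalent? k u v = all (λ w → ∣ u ∣[ w ] ≡ᵇ ∣ v ∣[ w ]) (wordsUpTo k)

equivalent?-sound : ∀ k u v → equivalent? k u v ≡ true → KAbelianEquivalent k u v
equivalent?-sound k u v e w _ le =
  ≡ᵇ-sound (all-sound (λ w → ∣ u ∣[ w ] ≡ᵇ ∣ v ∣[ w ]) (wordsUpTo k) e (∈-wordsUpTo k w le))

-- For `k ≥ 1` equivalent words have equally many zeros and equally many ones, hence the same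
-- length: the middle is the only possible place to split.
square? : ℕ → Word → Bool
square? k []      = false
square? k s@(_ ∷ _) = equivalent? k (take ⌊ length s /2⌋ s) (drop ⌊ length s /2⌋ s)

square?-sound : ∀ k s → square? k s ≡ true → KAbelianSquare k s
square?-sound k s@(_ ∷ _) e =
  (λ ()) , take h s , drop h s , sym (take++drop≡id h s) , equivalent?-sound k (take h s) (drop h s) e
  where h = ⌊ length s /2⌋

_≟ʷ_ : Word → Word → Bool
[]             ≟ʷ []             = true
(zero ∷ u)     ≟ʷ (zero ∷ v)     = u ≟ʷ v
(suc zero ∷ u) ≟ʷ (suc zero ∷ v) = u ≟ʷ v
_              ≟ʷ _              = false

≟ʷ-refl : ∀ u → (u ≟ʷ u) ≡ true
≟ʷ-refl []             = refl
≟ʷ-refl (zero ∷ u)     = ≟ʷ-refl u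
≟ʷ-refl (suc zero ∷ u) = ≟ʷ-refl u

-- Exhaustive search with a trie of squares

data Trie : Set where
  leaf : Trie
  node : Bool → Trie → Trie → Trie

-- The binary digits of a code are consumed from the least significant one, that is, from the last
-- letter of the word; the code 1 is the leading digit alone and marks the end. The first argument
-- is fuel.
insert : ℕ → ℕ → Trie → Trie
insert zero    _ t = t
insert (suc f) n leaf = insert' (n ≡ᵇ 1) (n % 2 ≡ᵇ 0)
  where
  insert' : Bool → Bool → Trie
  insert' true  _     = node true leaf leaf
  insert' false true  = node false (insert f (n / 2) leaf) leaf
  insert' false false = node false leaf (insert f (n / 2) leaf)
insert (suc f) n (node m l r) = insert' (n ≡ᵇ 1) (n % 2 ≡ᵇ 0)
  where
  insert' : Bool → Bool → Trie
  insert' true  _     = node true l r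
  insert' false true  = node m (insert f (n / 2) l) r
  insert' false false = node m l (insert f (n / 2) r)

-- `s` is the word spelled by the path from the node back up to the root, so deeper letters are
-- prepended. Each mark is tested afresh, and therefore nothing has to be proved about `squareCodes`
-- or `insert`.
verify : Trie → Word → Bool
verify leaf         s = true
verify (node m l r) s =
  (if m then square? 4 s else true) ∧ verify l (zero ∷ s) ∧ verify r (suc zero ∷ s)

_∈ᵇ_ : Word → List Word → Bool
s ∈ᵇ ws = foldr (λ w b → (s ≟ʷ w) ∨ b) false ws

add : Word → List Word → List Word
add s ws with s ∈ᵇ ws
... | true  = ws
... | false = s ∷ ws

suffixSquares : Trie → Word → Word → List Word → List Word
suffixSquares leaf         _                s ws = ws
suffixSquares (node m l r) []               s ws = if m then add s ws else ws
suffixSquares (node m l r) (zero ∷ rw)      s ws =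
  suffixSquares l rw (zero ∷ s) (if m then add s ws else ws)
suffixSquares (node m l r) (suc zero ∷ rw)  s ws =
  suffixSquares r rw (suc zero ∷ s) (if m then add s ws else ws)

search : ℕ → Trie → Word → List Word → Bool
branch : ℕ → Trie → Word → List Word → Bool
-- Exhausted fuel is failure, so success means that each branch has met four distinct squares in
-- time.
search zero    t rw ws = false
search (suc f) t rw ws =
  branch f t (zero ∷ rw) (suffixSquares t (zero ∷ rw) [] ws) ∧
  branch f t (suc zero ∷ rw) (suffixSquares t (suc zero ∷ rw) [] ws)
branch f t rw ws@(_ ∷ _ ∷ _ ∷ _ ∷ _) = true
branch f t rw ws = search f t rw ws

-- A word w is encoded as the binary numeral 1w.
squareCodes : List ℕ
squareCodes =
  4 ∷ 7 ∷ 16 ∷ 21 ∷ 26 ∷ 31 ∷ 64 ∷ 73 ∷ 82 ∷ 91 ∷ 100 ∷ 109 ∷ 118 ∷ 127 ∷ 256 ∷ 273 ∷ 290 ∷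
  307 ∷ 324 ∷ 341 ∷ 358 ∷ 375 ∷ 392 ∷ 409 ∷ 426 ∷ 443 ∷ 460 ∷ 477 ∷ 494 ∷ 511 ∷ 1057 ∷ 1090 ∷
  1123 ∷ 1156 ∷ 1222 ∷ 1255 ∷ 1288 ∷ 1420 ∷ 1486 ∷ 1519 ∷ 1552 ∷ 1585 ∷ 1651 ∷ 1783 ∷ 1816 ∷
  1849 ∷ 1915 ∷ 1948 ∷ 1981 ∷ 2014 ∷ 4161 ∷ 4226 ∷ 4291 ∷ 4356 ∷ 4421 ∷ 4486 ∷ 4551 ∷ 4616 ∷
  4746 ∷ 4811 ∷ 4876 ∷ 4941 ∷ 5006 ∷ 5071 ∷ 5136 ∷ 5201 ∷ 5331 ∷ 5396 ∷ 5526 ∷ 5591 ∷ 5656 ∷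
  5721 ∷ 5786 ∷ 5916 ∷ 5981 ∷ 6046 ∷ 6111 ∷ 6176 ∷ 6241 ∷ 6306 ∷ 6371 ∷ 6501 ∷ 6566 ∷ 6631 ∷
  6696 ∷ 6761 ∷ 6891 ∷ 6956 ∷ 7086 ∷ 7151 ∷ 7216 ∷ 7281 ∷ 7346 ∷ 7411 ∷ 7476 ∷ 7541 ∷ 7671 ∷
  7736 ∷ 7801 ∷ 7866 ∷ 7931 ∷ 7996 ∷ 8061 ∷ 8126 ∷ 16513 ∷ 16642 ∷ 16771 ∷ 16900 ∷ 17158 ∷
  17287 ∷ 17416 ∷ 17803 ∷ 17932 ∷ 18061 ∷ 18190 ∷ 18319 ∷ 18448 ∷ 19222 ∷ 19351 ∷ 19480 ∷
  19738 ∷ 19996 ∷ 20125 ∷ 20254 ∷ 20383 ∷ 20512 ∷ 20899 ∷ 21415 ∷ 22060 ∷ 22318 ∷ 22576 ∷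
  22705 ∷ 23092 ∷ 23608 ∷ 23737 ∷ 23866 ∷ 24124 ∷ 24382 ∷ 24511 ∷ 24640 ∷ 24769 ∷ 25027 ∷
  25285 ∷ 25414 ∷ 25543 ∷ 26059 ∷ 26446 ∷ 26575 ∷ 26833 ∷ 27091 ∷ 27736 ∷ 28252 ∷ 28639 ∷
  28768 ∷ 28897 ∷ 29026 ∷ 29155 ∷ 29413 ∷ 29671 ∷ 29800 ∷ 29929 ∷ 30703 ∷ 30832 ∷ 30961 ∷
  31090 ∷ 31219 ∷ 31348 ∷ 31735 ∷ 31864 ∷ 31993 ∷ 32251 ∷ 32380 ∷ 32509 ∷ 32638 ∷ 65793 ∷
  66050 ∷ 66564 ∷ 67335 ∷ 67592 ∷ 69134 ∷ 69648 ∷ 70419 ∷ 70933 ∷ 71447 ∷ 71961 ∷ 72732 ∷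
  72989 ∷ 73503 ∷ 73760 ∷ 74531 ∷ 75302 ∷ 76330 ∷ 77358 ∷ 78129 ∷ 78386 ∷ 79671 ∷ 79928 ∷
  80442 ∷ 80699 ∷ 81470 ∷ 81984 ∷ 83269 ∷ 83526 ∷ 83783 ∷ 85068 ∷ 86353 ∷ 87124 ∷ 87895 ∷
  89180 ∷ 89437 ∷ 90722 ∷ 91236 ∷ 92007 ∷ 93806 ∷ 94320 ∷ 94577 ∷ 95091 ∷ 95348 ∷ 95605 ∷
  95862 ∷ 97404 ∷ 98175 ∷ 98432 ∷ 99203 ∷ 100745 ∷ 101002 ∷ 101259 ∷ 101516 ∷ 102030 ∷ 102287 ∷
  102801 ∷ 104600 ∷ 105371 ∷ 105885 ∷ 107170 ∷ 107427 ∷ 108712 ∷ 109483 ∷ 110254 ∷ 111539 ∷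
  112824 ∷ 113081 ∷ 113338 ∷ 114623 ∷ 115137 ∷ 115908 ∷ 116165 ∷ 116679 ∷ 116936 ∷ 118221 ∷
  118478 ∷ 119249 ∷ 120277 ∷ 121305 ∷ 122076 ∷ 122847 ∷ 123104 ∷ 123618 ∷ 123875 ∷ 124646 ∷
  125160 ∷ 125674 ∷ 126188 ∷ 126959 ∷ 127473 ∷ 129015 ∷ 129272 ∷ 130043 ∷ 130557 ∷ 130814 ∷
  282151 ∷ 290359 ∷ 291385 ∷ 292411 ∷ 298567 ∷ 302158 ∷ 318574 ∷ 320113 ∷ 320626 ∷ 322678 ∷
  334990 ∷ 342172 ∷ 364231 ∷ 375004 ∷ 378082 ∷ 378595 ∷ 379108 ∷ 383212 ∷ 403219 ∷ 407323 ∷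
  407836 ∷ 408349 ∷ 411427 ∷ 422200 ∷ 444259 ∷ 451441 ∷ 463753 ∷ 465805 ∷ 466318 ∷ 467857 ∷
  484273 ∷ 487864 ∷ 494020 ∷ 495046 ∷ 496072 ∷ 504280 ∷ 1154151 ∷ 1166451 ∷ 1252551 ∷ 1259726 ∷
  1281251 ∷ 1284326 ∷ 1456526 ∷ 1470876 ∷ 1513926 ∷ 1520076 ∷ 1625651 ∷ 1631801 ∷ 1674851 ∷
  1689201 ∷ 1861401 ∷ 1864476 ∷ 1886001 ∷ 1893176 ∷ 1979276 ∷ 1991576 ∷ 18248039 ∷ 18248087 ∷
  18444647 ∷ 18444695 ∷ 18510247 ∷ 18657651 ∷ 18657739 ∷ 18665933 ∷ 18690515 ∷ 19690183 ∷
  19718862 ∷ 19718886 ∷ 19718958 ∷ 19804899 ∷ 20017863 ∷ 20042525 ∷ 20042637 ∷ 20112078 ∷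
  20112174 ∷ 20214599 ∷ 20243278 ∷ 20493195 ∷ 20501277 ∷ 20501389 ∷ 20538086 ∷ 20538262 ∷
  20554650 ∷ 20603814 ∷ 21443699 ∷ 21443811 ∷ 21787847 ∷ 21902451 ∷ 21902563 ∷ 22603150 ∷
  22603206 ∷ 22660508 ∷ 22832526 ∷ 22832582 ∷ 23303737 ∷ 23303793 ∷ 23303961 ∷ 23307834 ∷
  23308058 ∷ 23447132 ∷ 23533113 ∷ 23533169 ∷ 23545500 ∷ 23545652 ∷ 23651982 ∷ 23709340 ∷
  24209174 ∷ 24221241 ∷ 24221465 ∷ 24225338 ∷ 24225562 ∷ 24299308 ∷ 24332084 ∷ 24332108 ∷
  24430388 ∷ 24430412 ∷ 25901235 ∷ 25901259 ∷ 25999539 ∷ 25999563 ∷ 26032339 ∷ 26106085 ∷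
  26106309 ∷ 26110182 ∷ 26110406 ∷ 26122473 ∷ 26622307 ∷ 26679665 ∷ 26785995 ∷ 26786147 ∷
  26798478 ∷ 26798534 ∷ 26884515 ∷ 27023589 ∷ 27023813 ∷ 27027686 ∷ 27027854 ∷ 27027910 ∷
  27499065 ∷ 27499121 ∷ 27671139 ∷ 27728441 ∷ 27728497 ∷ 28429084 ∷ 28429196 ∷ 28543800 ∷
  28887836 ∷ 28887948 ∷ 29727833 ∷ 29776997 ∷ 29793385 ∷ 29793561 ∷ 29830258 ∷ 29830370 ∷
  29838452 ∷ 30088369 ∷ 30117048 ∷ 30219473 ∷ 30219569 ∷ 30289010 ∷ 30289122 ∷ 30313784 ∷
  30526748 ∷ 30612689 ∷ 30612761 ∷ 30612785 ∷ 30641464 ∷ 31641132 ∷ 31665714 ∷ 31673908 ∷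
  31673996 ∷ 31821400 ∷ 31886952 ∷ 31887000 ∷ 32083560 ∷ 32083608 ∷ 87607526 ∷ 94129266 ∷
  107197325 ∷ 113719065 ∷ 292734411 ∷ 296175261 ∷ 314952471 ∷ 317033366 ∷ 323915066 ∷
  329469581 ∷ 342479271 ∷ 350802851 ∷ 361469486 ∷ 365631276 ∷ 372136121 ∷ 379394676 ∷
  388783281 ∷ 390503706 ∷ 414802661 ∷ 416523086 ∷ 425911691 ∷ 433170246 ∷ 439675091 ∷
  443836881 ∷ 454503516 ∷ 462827096 ∷ 475836786 ∷ 481391301 ∷ 488273001 ∷ 490353896 ∷
  509131106 ∷ 512571956 ∷ 92729336550 ∷ 96442355354 ∷ 109716074853 ∷ 113429093657 ∷
  298740922571 ∷ 299680446667 ∷ 299680446819 ∷ 299762235751 ∷ 301425277131 ∷ 302136216343 ∷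
  302197040523 ∷ 303040096467 ∷ 303213105949 ∷ 303213106061 ∷ 305830356637 ∷ 306127104211 ∷
  322510086883 ∷ 322510090595 ∷ 322603938198 ∷ 323074220775 ∷ 323074220951 ∷ 323074221847 ∷
  324482986390 ∷ 324482986694 ∷ 324642894183 ∷ 324646564558 ∷ 327972647318 ∷ 328370589325 ∷
  329394525742 ∷ 329394525974 ∷ 331202285990 ∷ 331548304954 ∷ 331548305178 ∷ 331689337767 ∷
  331689338695 ∷ 335785084363 ∷ 336495994647 ∷ 336556836299 ∷ 336767600285 ∷ 336782806330 ∷
  337376301478 ∷ 337396748749 ∷ 337631629773 ∷ 350681183431 ∷ 350695864931 ∷ 351335496103 ∷
  356970554275 ∷ 356970557859 ∷ 358851688871 ∷ 359227094131 ∷ 370142266822 ∷ 370142274246 ∷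
  370329969452 ∷ 371270534958 ∷ 371270536750 ∷ 374088065836 ∷ 374407881422 ∷ 374415222172 ∷
  381057439513 ∷ 381477395738 ∷ 381507816564 ∷ 381808250033 ∷ 381863271706 ∷ 383911144540 ∷
  383911145004 ∷ 385570519225 ∷ 387526665036 ∷ 388218702964 ∷ 388218703412 ∷ 388218703500 ∷
  388500768590 ∷ 388500770446 ∷ 396692261782 ∷ 396840635569 ∷ 398149260857 ∷ 398149260913 ∷
  398235765654 ∷ 398657293626 ∷ 398687705716 ∷ 399874696012 ∷ 399915590554 ∷ 400385352602 ∷
  424248368229 ∷ 424718130277 ∷ 424759024819 ∷ 425946015115 ∷ 425976427205 ∷ 426397955177 ∷
  426484459918 ∷ 426484459974 ∷ 427793085262 ∷ 427941459049 ∷ 436132950385 ∷ 436132952241 ∷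
  436415017331 ∷ 436415017419 ∷ 436415017867 ∷ 437107055795 ∷ 439063201606 ∷ 440722575827 ∷
  440722576291 ∷ 442770449125 ∷ 442825470798 ∷ 443125904267 ∷ 443156325093 ∷ 443576281318 ∷
  450218498659 ∷ 450225839409 ∷ 450545654995 ∷ 453363184081 ∷ 453363185873 ∷ 454303751379 ∷
  454491446585 ∷ 454491454009 ∷ 465406626700 ∷ 465782031960 ∷ 467663162972 ∷ 467663166556 ∷
  473298224728 ∷ 473937855900 ∷ 473952537400 ∷ 487002091058 ∷ 487236972082 ∷ 487257419353 ∷
  487850914501 ∷ 487866120546 ∷ 488076884532 ∷ 488137726184 ∷ 488848636468 ∷ 492944382136 ∷
  492944383064 ∷ 493085415653 ∷ 493085415877 ∷ 493431434841 ∷ 495239194857 ∷ 495239195089 ∷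
  496263131506 ∷ 496661073513 ∷ 499987156273 ∷ 499990826648 ∷ 500150734137 ∷ 500150734441 ∷
  501559498984 ∷ 501559499880 ∷ 501559500056 ∷ 502029782633 ∷ 502123630236 ∷ 502123633948 ∷
  518506616620 ∷ 518803364194 ∷ 521420614770 ∷ 521420614882 ∷ 521593624364 ∷ 522436680308 ∷
  522497504488 ∷ 523208443700 ∷ 524871485080 ∷ 524953274012 ∷ 524953274164 ∷ 525892798260 ∷
  1194964640663 ∷ 1194964641559 ∷ 1198672409287 ∷ 1198722737047 ∷ 1212161303463 ∷
  1212161304391 ∷ 1221325867915 ∷ 1221546069277 ∷ 1222747723543 ∷ 1222869371787 ∷
  1224509334439 ∷ 1224549192589 ∷ 1225018954525 ∷ 1225018954637 ∷ 1290417653550 ∷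
  1290417655342 ∷ 1297825842631 ∷ 1297825850055 ∷ 1297833190798 ∷ 1297933846318 ∷
  1324810979150 ∷ 1324810981006 ∷ 1343140061998 ∷ 1343140108054 ∷ 1343550098717 ∷
  1343580510778 ∷ 1346227115566 ∷ 1346227115798 ∷ 1349507041102 ∷ 1349586757402 ∷
  1350526281274 ∷ 1350526281498 ∷ 1405334381383 ∷ 1405737003463 ∷ 1405766366435 ∷
  1435399145287 ∷ 1435399152455 ∷ 1481323679324 ∷ 1481323682908 ∷ 1496140057486 ∷
  1496140072334 ∷ 1496154753820 ∷ 1496356064860 ∷ 1527248206193 ∷ 1550110330524 ∷
  1550110334236 ∷ 1586513778233 ∷ 1586513778289 ∷ 1586768588332 ∷ 1587377748337 ∷
  1587588569658 ∷ 1587649393780 ∷ 1588360321594 ∷ 1592942603356 ∷ 1592942603820 ∷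
  1599502454428 ∷ 1599661887028 ∷ 1601071127836 ∷ 1601540934772 ∷ 1601540935220 ∷
  1696993948107 ∷ 1696993948555 ∷ 1697463755491 ∷ 1698872996299 ∷ 1699032428899 ∷
  1705592279507 ∷ 1705592279971 ∷ 1710174561733 ∷ 1710885489547 ∷ 1710946313669 ∷
  1711157134990 ∷ 1711766294995 ∷ 1712021105038 ∷ 1712021105094 ∷ 1748424549091 ∷
  1748424552803 ∷ 1771286677134 ∷ 1802178818467 ∷ 1802380129507 ∷ 1802394810993 ∷
  1802394825841 ∷ 1817211200419 ∷ 1817211204003 ∷ 1863135730872 ∷ 1863135738040 ∷
  1892768516892 ∷ 1892797879864 ∷ 1893200501944 ∷ 1948008601829 ∷ 1948008602053 ∷
  1948948125925 ∷ 1949027842225 ∷ 1952307767529 ∷ 1952307767761 ∷ 1954954372549 ∷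
  1954984784610 ∷ 1955394775273 ∷ 1955394821329 ∷ 1973723902321 ∷ 1973723904177 ∷
  2000601037009 ∷ 2000701692529 ∷ 2000709033272 ∷ 2000709040696 ∷ 2008117227985 ∷
  2008117229777 ∷ 2073515928690 ∷ 2073515928802 ∷ 2073985690738 ∷ 2074025548888 ∷
  2075665511540 ∷ 2075787159784 ∷ 2076988814050 ∷ 2077209015412 ∷ 2086373578936 ∷
  2086373579864 ∷ 2099812146280 ∷ 2099862474040 ∷ 2103570241768 ∷ 2103570242664 ∷
  308659554444007 ∷ 309390503983463 ∷ 313054983559539 ∷ 313054983564403 ∷ 313054983564515 ∷
  313169907888589 ∷ 335793816920775 ∷ 336223313650375 ∷ 337306031256270 ∷ 343919895044807 ∷
  344634990408422 ∷ 344634990418150 ∷ 344634990418374 ∷ 344864839066522 ∷ 365532977968327 ∷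
  380183464437148 ∷ 390990005898908 ∷ 394838296596124 ∷ 395053044960924 ∷ 408254701429580 ∷
  436170228702387 ∷ 449371885171043 ∷ 449586633535843 ∷ 453434924233059 ∷ 464241465694819 ∷
  478891952163640 ∷ 499560091065445 ∷ 499789939713593 ∷ 499789939713817 ∷ 499789939723545 ∷
  500505035087160 ∷ 507118898875697 ∷ 508201616481592 ∷ 508631113211192 ∷ 531255022243378 ∷
  531369946567452 ∷ 531369946567564 ∷ 531369946572428 ∷ 535034426148504 ∷ 535765375687960 ∷
  5426425778197277 ∷ 5756280748167635 ∷ 6129058880657174 ∷ 6243412593022745 ∷
  6293986365642353 ∷ 6317187245955257 ∷ 6349251929024058 ∷ 6501837013146713 ∷
  6501837014064305 ∷ 6522699816605297 ∷ 6524720066017457 ∷ 6986078816094030 ∷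
  6988099065506190 ∷ 7008961868047182 ∷ 7008961868964774 ∷ 7161546953087429 ∷
  7193611636156230 ∷ 7216812516469134 ∷ 7267386289088742 ∷ 7381740001454313 ∷
  7754518133943852 ∷ 8084373103914210 ∷ 1257293963451906227 ∷ 1257293963451906251 ∷
  1267251308266043751 ∷ 1271767335385491101 ∷ 1282745467225303251 ∷ 1352710707880597875 ∷
  1352710707880602739 ∷ 1352710707880602851 ∷ 1355076362984540951 ∷ 1361666422296965526 ∷
  1375411474107909579 ∷ 1377170692712351179 ∷ 1377208284384284301 ∷ 1381581111925240526 ∷
  1382097960748763927 ∷ 1390613166164135226 ∷ 1391204579940119751 ∷ 1408695890103944651 ∷
  1412569429843759526 ∷ 1415058766047293901 ∷ 1470863338453219751 ∷ 1497223575702918051 ∷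
  1506686196118670451 ∷ 1552499911154348774 ∷ 1552499911154358502 ∷ 1552499911154358726 ∷
  1557231221362234926 ∷ 1570411339987084076 ∷ 1597901443608972182 ∷ 1598313626190047001 ∷
  1601419880817855382 ∷ 1601495064161721626 ∷ 1610240719243634076 ∷ 1617238867021551801 ∷
  1617257662857518362 ∷ 1618137272159739162 ∷ 1628304827721423476 ∷ 1629487655273392526 ∷
  1629487655273392582 ∷ 1629487655273395014 ∷ 1664470275601042326 ∷ 1669959341520948401 ∷
  1672217355080672076 ∷ 1677196027487740826 ∷ 1781568486332800101 ∷ 1786547158739868851 ∷
  1788805172299592526 ∷ 1794294238219498601 ∷ 1829276858547145913 ∷ 1829276858547148345 ∷
  1829276858547148401 ∷ 1830459686099117451 ∷ 1840627241660801765 ∷ 1841506850963022565 ∷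
  1841525646798989126 ∷ 1848523794576906851 ∷ 1857269449658819301 ∷ 1857344633002685545 ∷
  1860450887630493926 ∷ 1860863070211568745 ∷ 1888353173833456851 ∷ 1901533292458306001 ∷
  1906264602666182201 ∷ 1906264602666182425 ∷ 1906264602666192153 ∷ 1952078317701870476 ∷
  1961540938117622876 ∷ 1987901175367321176 ∷ 2043705747773247026 ∷ 2046195083976781401 ∷
  2050068623716596276 ∷ 2067559933880421176 ∷ 2068151347656405701 ∷ 2076666553071777000 ∷
  2077183401895300401 ∷ 2081556229436256626 ∷ 2081593821108189748 ∷ 2083353039712631348 ∷
  2097098091523575401 ∷ 2103688150835999976 ∷ 2106053805939938076 ∷ 2106053805939938188 ∷
  2106053805939943052 ∷ 2176019046595237676 ∷ 2186997178435049826 ∷ 2191513205554497176 ∷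
  2201470550368634676 ∷ 2201470550368634700 ∷ []

Sound : Trie → Word → Set
Sound t s = verify t s ≡ true

-- Soundness of the search

∉ᵇ⇒fresh : ∀ s ws → s ∈ᵇ ws ≡ false → All (s ≢_) ws
∉ᵇ⇒fresh s []       _ = []
∉ᵇ⇒fresh s (w ∷ ws) e with s ≟ʷ w in eq
... | false = (λ { refl → contra (trans (sym eq) (≟ʷ-refl s)) }) ∷ ∉ᵇ⇒fresh s ws e
  where
  contra : false ≢ true
  contra ()

module _ (x : InfWord) where

  Found : List Word → Set
  Found ws = Unique ws × All (KAbelianSquareIn 4 x) ws

  add-found : ∀ s ws → KAbelianSquareIn 4 x s → Found ws → Found (add s ws)
  add-found s ws sq (uniq , sqs) with s ∈ᵇ ws in eq
  ... | true  = uniq , sqs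
  ... | false = (∉ᵇ⇒fresh s ws eq ∷ uniq) , (sq ∷ sqs)

  reversedPrefix : ℕ → Word
  reversedPrefix zero    = []
  reversedPrefix (suc n) = x n ∷ reversedPrefix n

  segment : ℕ → ℕ → Word
  segment i n = applyUpTo (λ j → x (i + j)) n

  segment-suc : ∀ i n → segment i (suc n) ≡ x i ∷ segment (suc i) n
  segment-suc i n = cong₂ _∷_ (cong x (+-identityʳ i)) (go n (λ j → cong x (+-suc i j)))
    where
    go : ∀ {f g : ℕ → Fin 2} n → (∀ j → f j ≡ g j) → applyUpTo f n ≡ applyUpTo g n
    go zero    h = refl
    go (suc n) h = cong₂ _∷_ (h 0) (go n (λ j → h (suc j)))

  segment-length : ∀ i n → length (segment i n) ≡ n
  segment-length i n = length-applyUpTo (λ j → x (i + j)) n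

  segment-factor : ∀ i n → segment i n FactorOf x
  segment-factor i n = i , cong (segment i) (sym (segment-length i n))

  mark-found : ∀ m i n ws → (if m then square? 4 (segment i n) else true) ≡ true → Found ws →
               Found (if m then add (segment i n) ws else ws)
  mark-found true  i n ws ok fd =
    add-found (segment i n) ws (square?-sound 4 (segment i n) ok , segment-factor i n) fd
  mark-found false i n ws ok fd = fd

  -- Invariant of the walk: after `n` letters have been read backwards, the position `i` has been
  -- reached and the path taken in the trie spells `segment i n`. A marked node is thus a square
  -- that occurs in `x`.
  suffixSquares-found : ∀ t i n ws → Sound t (segment i n) → Found ws →
                        Found (suffixSquares t (reversedPrefix i) (segment i n) ws)
  suffixSquares-found leaf         i       n ws ok fd = fd
  suffixSquares-found (node m l r) zero    n ws ok fd =
    mark-found m 0 n ws (proj₁ (∧-split ok)) fd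
  suffixSquares-found (node m l r) (suc i) n ws ok fd
    with okm , oklr ← ∧-split {if m then square? 4 (segment (suc i) n) else true} ok
    with okl , okr ← ∧-split {verify l (zero ∷ segment (suc i) n)} oklr
    with mark-found m (suc i) n ws okm fd | segment-suc i n
  ... | fd' | seg with x i
  ... | zero     rewrite sym seg = suffixSquares-found l i (suc n) _ okl fd'
  ... | suc zero rewrite sym seg = suffixSquares-found r i (suc n) _ okr fd'

  -- The letters of `x` select one path of the search tree; only the branch that agrees with `x n`
  -- is followed, and all squares collected on it occur in `x`.
  branch-sound : ∀ f t n ws → Sound t [] → Found ws → branch f t (reversedPrefix n) ws ≡ true →
                 HasAtLeast 4 (KAbelianSquareIn 4 x)
  search-sound : ∀ f t n ws → Sound t [] → Found ws → search f t (reversedPrefix n) ws ≡ true →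
                 HasAtLeast 4 (KAbelianSquareIn 4 x)
  branch-sound f t n (a ∷ b ∷ c ∷ d ∷ ws) ok
    (((ab ∷ ac ∷ ad ∷ _) ∷ (bc ∷ bd ∷ _) ∷ (cd ∷ _) ∷ _) , (sa ∷ sb ∷ sc ∷ sd ∷ _)) e =
    a ∷ b ∷ c ∷ d ∷ [] , refl ,
    ((ab ∷ ac ∷ ad ∷ []) ∷ (bc ∷ bd ∷ []) ∷ (cd ∷ []) ∷ [] ∷ []) ,
    (sa ∷ sb ∷ sc ∷ sd ∷ [])
  branch-sound f t n []              ok fd e = search-sound f t n [] ok fd e
  branch-sound f t n ws@(_ ∷ [])     ok fd e = search-sound f t n ws ok fd e
  branch-sound f t n ws@(_ ∷ _ ∷ []) ok fd e = search-sound f t n ws ok fd e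
  branch-sound f t n ws@(_ ∷ _ ∷ _ ∷ []) ok fd e = search-sound f t n ws ok fd e
  search-sound (suc f) t n ws ok fd e
    with e₀ , e₁ ← ∧-split
           {branch f t (zero ∷ reversedPrefix n) (suffixSquares t (zero ∷ reversedPrefix n) [] ws)} e
    with suffixSquares-found t (suc n) 0 ws ok fd
       | branch-sound f t (suc n) (suffixSquares t (reversedPrefix (suc n)) [] ws) ok
  ... | fd' | ih with x n
  ... | zero     = ih fd' e₀
  ... | suc zero = ih fd' e₁

  four-squares : ∀ f t → verify t [] ≡ true → search f t [] [] ≡ true →
                 HasAtLeast 4 (KAbelianSquareIn 4 x)
  four-squares f t ok e = search-sound f t 0 [] ok ([] , []) e

trie : Trie
-- The longest code has 61 binary digits, so fuel 70 suffices to insert every word.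
trie = foldr (insert 70) leaf squareCodes

search-succeeds : search 95 trie [] [] ≡ true
search-succeeds = refl

verify-trie : verify trie [] ≡ true
verify-trie = refl

atLeastFour : ∀ (x : InfWord) → HasAtLeast 4 (KAbelianSquareIn 4 x)
atLeastFour x = four-squares x 95 trie verify-trie search-succeeds

≡ᵇ-complete : ∀ {m n} → m ≡ n → (m ≡ᵇ n) ≡ true
≡ᵇ-complete {m} refl = Equivalence.to T-≡ (≡⇒≡ᵇ m m refl)

any-sound : ∀ {A : Set} (p : A → Bool) xs → any p xs ≡ true → ∃[ x ] (x ∈ xs × p x ≡ true)
any-sound p (x ∷ xs) e with p x in px
... | true  = x , here refl , px
... | false with y , y∈ , py ← any-sound p xs e = y , there y∈ , py

nth : ∀ {A : Set} → A → List A → ℕ → A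
nth d []       _       = d
nth d (x ∷ xs) zero    = x
nth d (x ∷ xs) (suc n) = nth d xs n

nth-applyUpTo : ∀ {A : Set} (d : A) f {n i} → i < n → nth d (applyUpTo f n) i ≡ f i
nth-applyUpTo d f {suc n} {zero}  _         = refl
nth-applyUpTo d f {suc n} {suc i} (s≤s i<n) = nth-applyUpTo d (λ j → f (suc j)) i<n

letters : List ℕ
letters = upTo 5

-- Sums over initial segments

∑ : ℕ → (ℕ → ℤ) → ℤ
∑ zero    f = 0ℤ
∑ (suc n) f = ∑ n f ℤ.+ f n

∑-cong : ∀ n {f g} → (∀ i → i < n → f i ≡ g i) → ∑ n f ≡ ∑ n g
∑-cong zero    h = refl
∑-cong (suc n) h = cong₂ ℤ._+_ (∑-cong n (λ i i<n → h i (m<n⇒m<1+n i<n))) (h n ≤-refl)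

∑-+ : ∀ m n f → ∑ (n + m) f ≡ ∑ m f ℤ.+ ∑ n (λ i → f (i + m))
∑-+ m zero    f = sym (ℤ.+-identityʳ _)
∑-+ m (suc n) f = trans (cong (ℤ._+ f (n + m)) (∑-+ m n f)) (ℤ.+-assoc (∑ m f) _ _)

∑-scale : ∀ n c f → ∑ n (λ i → c ℤ.* f i) ≡ c ℤ.* ∑ n f
∑-scale zero    c f = sym (ℤ.*-zeroʳ c)
∑-scale (suc n) c f = trans (cong (ℤ._+ c ℤ.* f n) (∑-scale n c f)) (sym (ℤ.*-distribˡ-+ c _ _))

∑-add : ∀ n f g → ∑ n (λ i → f i ℤ.+ g i) ≡ ∑ n f ℤ.+ ∑ n g
∑-add zero    f g = refl
∑-add (suc n) f g = trans (cong (ℤ._+ (f n ℤ.+ g n)) (∑-add n f g)) (swap (∑ n f) (∑ n g) (f n) (g n))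
  where
  swap : ∀ a b c d → (a ℤ.+ b) ℤ.+ (c ℤ.+ d) ≡ (a ℤ.+ c) ℤ.+ (b ℤ.+ d)
  swap = solve-∀

-- All initial sums of a block are obtained in one pass; the large checks by evaluation then look
-- values up instead of summing again.
partial-sums : (ℕ → ℤ) → ℤ → ℕ → ℕ → List ℤ
partial-sums f s i zero    = s ∷ []
partial-sums f s i (suc n) = s ∷ partial-sums f (s ℤ.+ f i) (suc i) n

nth-partial-sums : ∀ f n i r → r ≤ n → nth 0ℤ (partial-sums f (∑ i f) i n) r ≡ ∑ (r + i) f
nth-partial-sums f zero    i zero    _         = refl
nth-partial-sums f (suc n) i zero    _         = refl
nth-partial-sums f (suc n) i (suc r) (s≤s r≤n) =
  trans (nth-partial-sums f n (suc i) r r≤n) (cong (λ k → ∑ k f) (+-suc r i))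

nth-map-upTo : ∀ {A : Set} (d : A) (f : ℕ → A) n {i} → i < n → nth d (map f (upTo n)) i ≡ f i
nth-map-upTo d f n i<n = trans (cong (λ l → nth d l _) (map-upTo f n)) (nth-applyUpTo d f i<n)

δ : ℕ → ℕ → ℤ
δ i j = if i ≡ᵇ j then 1ℤ else 0ℤ

-- The abelian-square-free word

image : List ℕ
image = 0 ∷ 3 ∷ 1 ∷ 0 ∷ 4 ∷ 0 ∷ 1 ∷ 0 ∷ 4 ∷ 2 ∷ 0 ∷ 4 ∷ 3 ∷ 2 ∷ 1 ∷ 0 ∷ []

f₀ : ℕ → ℕ
f₀ = nth 0 image

-- The image of the letter `b` is `image` rotated by `b` modulo 5. The first argument is fuel for
-- the recursion through the base-16 digits of `n`, and `n` steps are enough.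
approx : ℕ → ℕ → ℕ
approx zero    n = 0
approx (suc k) n = (approx k (n / 16) + f₀ (n % 16)) % 5

a : ℕ → ℕ
a n = approx n n

approx-0 : ∀ k → approx k 0 ≡ 0
approx-0 zero    = refl
approx-0 (suc k) = cong (λ m → (m + 0) % 5) (approx-0 k)

n/16≤k : ∀ {n k} → n ≤ suc k → n / 16 ≤ k
n/16≤k {zero}  _         = z≤n
n/16≤k {suc n} (s≤s n≤k) = ≤-trans (≤-pred (m/n<m (suc n) 16 (s≤s (s≤s z≤n)))) n≤k

approx-stable : ∀ k l n → n ≤ k → n ≤ l → approx k n ≡ approx l n
approx-stable zero    l       .0 z≤n _   = sym (approx-0 l)
approx-stable (suc k) zero    .0 _   z≤n = approx-0 (suc k)
approx-stable (suc k) (suc l) n  p   q   =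
  cong (λ m → (m + f₀ (n % 16)) % 5) (approx-stable k l (n / 16) (n/16≤k p) (n/16≤k q))

a-unfold : ∀ n → a n ≡ (a (n / 16) + f₀ (n % 16)) % 5
a-unfold n = trans (approx-stable n (suc n) n ≤-refl (n≤1+n n))
  (cong (λ m → (m + f₀ (n % 16)) % 5) (approx-stable n (n / 16) (n / 16) (m/n≤m n 16) ≤-refl))

divmod-unique : ∀ L .{{_ : NonZero L}} q r → r < L → (r + q * L) / L ≡ q × (r + q * L) % L ≡ r
divmod-unique L q r r<L =
  trans (+-distrib-/ r (q * L) lt)
        (cong₂ _+_ (m<n⇒m/n≡0 r<L) (m*n/n≡m q L)) ,
  trans ([m+kn]%n≡m%n r q L) (m<n⇒m%n≡m r<L)
  where
  lt : r % L + (q * L) % L < L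
  lt = subst (_< L) (sym (trans (cong₂ _+_ (m<n⇒m%n≡m r<L) (m*n%n≡0 q L)) (+-identityʳ r))) r<L

a-block : ∀ q r → r < 16 → a (r + q * 16) ≡ (a q + f₀ r) % 5
a-block q r r<16 with eq , er ← divmod-unique 16 q r r<16 =
  trans (a-unfold (r + q * 16)) (cong₂ (λ s t → (a s + f₀ t) % 5) eq er)

a<5 : ∀ n → a n < 5
a<5 n = subst (_< 5) (sym (a-unfold n)) (m%n<n (a (n / 16) + f₀ (n % 16)) 5)

-- Consecutive letters of `a` differ by 1, 3 or 4 modulo 5. Knowing the possible neighbours helps to
-- decide later whether shifted cut points can coincide.
step : ℕ → ℕ → Bool
step b c = any (λ s → (b + s) % 5 ≡ᵇ c) (1 ∷ 3 ∷ 4 ∷ [])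

all-upTo : ∀ {n} (p : ℕ → Bool) → all p (upTo n) ≡ true → ∀ {i} → i < n → p i ≡ true
all-upTo {n} p e i<n = all-sound p (upTo n) e (∈-upTo⁺ i<n)

step-inside : ∀ b r → b < 5 → r < 15 → step ((b + f₀ r) % 5) ((b + f₀ (suc r)) % 5) ≡ true
step-inside b r b<5 r<15 =
  all-upTo (λ r → step ((b + f₀ r) % 5) ((b + f₀ (suc r)) % 5))
    (all-upTo (λ b → all (λ r → step ((b + f₀ r) % 5) ((b + f₀ (suc r)) % 5)) (upTo 15)) refl b<5) r<15

a-multiple : ∀ q → a (q * 16) ≡ a q
a-multiple q = trans (a-block q 0 (s≤s z≤n))
  (trans (cong (_% 5) (+-identityʳ (a q))) (m<n⇒m%n≡m (a<5 q)))

a-end : ∀ q → a (15 + q * 16) ≡ a q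
a-end q = trans (a-block q 15 (s≤s ≤-refl))
  (trans (cong (_% 5) (+-identityʳ (a q))) (m<n⇒m%n≡m (a<5 q)))

-- Inside a block this is a finite check. Since `image` begins and ends with 0, every block begins
-- and ends with the letter that it replaces, so a step across a boundary repeats a step of `a` at
-- the smaller index `q`.
a-step : ∀ n → step (a n) (a (suc n)) ≡ true
a-step = <-rec _ go
  where
  go : ∀ n → (∀ {m} → m < n → step (a m) (a (suc m)) ≡ true) → step (a n) (a (suc n)) ≡ true
  go n ih with n % 16 | n / 16 | m≡m%n+[m/n]*n n 16 | m%n<n n 16
  ... | r | q | refl | r<16 with m≤n⇒m<n∨m≡n (≤-pred r<16)
  ... | inj₁ r<15 = subst₂ (λ b c → step b c ≡ true)
    (sym (a-block q r r<16)) (sym (a-block q (suc r) (s≤s r<15))) (step-inside (a q) r (a<5 q) r<15)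
  ... | inj₂ refl = subst₂ (λ b c → step b c ≡ true)
    (sym (a-end q)) (sym (a-multiple (suc q)))
    (ih (s≤s (≤-trans (m≤m*n q 16) (m≤n+m (q * 16) 14))))

-- Letter counts and cut points

V : ℕ → ℕ → ℤ
V i q = ∑ q (λ j → δ i (a j))

-- A second difference: the number of letters `i` between `q₂` and `q₃` minus the number between
-- `q₁` and `q₂`.
Δ : ℕ → ℕ → ℕ → ℕ → ℤ
Δ i q₁ q₂ q₃ = V i q₁ ℤ.+ V i q₃ ℤ.- (V i q₂ ℤ.+ V i q₂)

AbelianSquare : ℕ → ℕ → ℕ → Set
AbelianSquare q₁ q₂ q₃ = q₁ < q₂ × q₂ < q₃ × (∀ i → i < 5 → Δ i q₁ q₂ q₃ ≡ 0ℤ)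

<5-cases : ∀ {P : ℕ → Set} → P 0 → P 1 → P 2 → P 3 → P 4 → ∀ i → i < 5 → P i
<5-cases p0 p1 p2 p3 p4 0 _ = p0
<5-cases p0 p1 p2 p3 p4 1 _ = p1
<5-cases p0 p1 p2 p3 p4 2 _ = p2
<5-cases p0 p1 p2 p3 p4 3 _ = p3
<5-cases p0 p1 p2 p3 p4 4 _ = p4
<5-cases p0 p1 p2 p3 p4 (suc (suc (suc (suc (suc i))))) (s≤s (s≤s (s≤s (s≤s (s≤s ())))))

letter-weight : ∀ (w : ℕ → ℤ) c → c < 5 → w c ≡ ∑ 5 (λ i → w i ℤ.* δ i c)
letter-weight w = <5-cases (l0 (w 0) (w 1) (w 2) (w 3) (w 4)) (l1 (w 0) (w 1) (w 2) (w 3) (w 4))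
  (l2 (w 0) (w 1) (w 2) (w 3) (w 4)) (l3 (w 0) (w 1) (w 2) (w 3) (w 4)) (l4 (w 0) (w 1) (w 2) (w 3) (w 4))
  where
  l0 : ∀ a b c d e → a ≡ 0ℤ ℤ.+ a ℤ.* 1ℤ ℤ.+ b ℤ.* 0ℤ ℤ.+ c ℤ.* 0ℤ ℤ.+ d ℤ.* 0ℤ ℤ.+ e ℤ.* 0ℤ
  l0 = solve-∀
  l1 : ∀ a b c d e → b ≡ 0ℤ ℤ.+ a ℤ.* 0ℤ ℤ.+ b ℤ.* 1ℤ ℤ.+ c ℤ.* 0ℤ ℤ.+ d ℤ.* 0ℤ ℤ.+ e ℤ.* 0ℤ
  l1 = solve-∀
  l2 : ∀ a b c d e → c ≡ 0ℤ ℤ.+ a ℤ.* 0ℤ ℤ.+ b ℤ.* 0ℤ ℤ.+ c ℤ.* 1ℤ ℤ.+ d ℤ.* 0ℤ ℤ.+ e ℤ.* 0ℤ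
  l2 = solve-∀
  l3 : ∀ a b c d e → d ≡ 0ℤ ℤ.+ a ℤ.* 0ℤ ℤ.+ b ℤ.* 0ℤ ℤ.+ c ℤ.* 0ℤ ℤ.+ d ℤ.* 1ℤ ℤ.+ e ℤ.* 0ℤ
  l3 = solve-∀
  l4 : ∀ a b c d e → e ≡ 0ℤ ℤ.+ a ℤ.* 0ℤ ℤ.+ b ℤ.* 0ℤ ℤ.+ c ℤ.* 0ℤ ℤ.+ d ℤ.* 0ℤ ℤ.+ e ℤ.* 1ℤ
  l4 = solve-∀

weight-sum : ∀ (w : ℕ → ℤ) n → ∑ n (λ j → w (a j)) ≡ ∑ 5 (λ i → w i ℤ.* V i n)
weight-sum w zero    = sym (∑-cong 5 {λ i → w i ℤ.* 0ℤ} {λ _ → 0ℤ} (λ i _ → ℤ.*-zeroʳ (w i)))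
weight-sum w (suc n) = begin
  ∑ n (λ j → w (a j)) ℤ.+ w (a n)
    ≡⟨ cong₂ ℤ._+_ (weight-sum w n) (letter-weight w (a n) (a<5 n)) ⟩
  ∑ 5 (λ i → w i ℤ.* V i n) ℤ.+ ∑ 5 (λ i → w i ℤ.* δ i (a n))
    ≡⟨ sym (∑-add 5 (λ i → w i ℤ.* V i n) (λ i → w i ℤ.* δ i (a n))) ⟩
  ∑ 5 (λ i → w i ℤ.* V i n ℤ.+ w i ℤ.* δ i (a n))
    ≡⟨ sym (∑-cong 5 {λ i → w i ℤ.* V i (suc n)} {λ i → w i ℤ.* V i n ℤ.+ w i ℤ.* δ i (a n)}
              (λ i _ → ℤ.*-distribˡ-+ (w i) (V i n) (δ i (a n)))) ⟩
  ∑ 5 (λ i → w i ℤ.* V i (suc n)) ∎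
  where open ≡-Reasoning

-- Block substitutions

∑-blocks : ∀ L (g : ℕ → ℤ) (h : ℕ → ℕ → ℤ) → (∀ q r → r < L → g (r + q * L) ≡ h (a q) r) →
           ∀ q → ∑ (q * L) g ≡ ∑ q (λ j → ∑ L (h (a j)))
∑-blocks L g h gh zero    = refl
∑-blocks L g h gh (suc q) = trans (∑-+ (q * L) L g)
  (cong₂ ℤ._+_ (∑-blocks L g h gh q) (∑-cong L (gh q)))

-- The range `R` may exceed the block length `L`: the end of the sum may lie beyond the block of
-- `q`, as long as `h (a q)` still predicts the values there. The second reading of the middle cut
-- point requires this.
∑-block-offset : ∀ L R d (g : ℕ → ℤ) h i → i < 5 →
  (∀ q r → r < R → g (r + q * L) ≡ h (a q) r) → L ≤ R →
  (∀ b → b < 5 → ∑ L (h b) ≡ d ℤ.* δ i b) →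
  ∀ q r → r ≤ R → ∑ (r + q * L) g ≡ d ℤ.* V i q ℤ.+ ∑ r (h (a q))
∑-block-offset L R d g h i i<5 gh L≤R sums q r r≤R = trans (∑-+ (q * L) r g) (cong₂ ℤ._+_
  (trans (∑-blocks L g h (λ q r r<L → gh q r (≤-trans r<L L≤R)) q)
    (trans (∑-cong q (λ j _ → sums (a j) (a<5 j))) (∑-scale q d (λ j → δ i (a j)))))
  (∑-cong r (λ t t<r → gh q t (≤-trans t<r r≤R))))

V-total : ∀ q → ∑ 5 (λ i → V i q) ≡ + q
V-total q = trans (∑-cong 5 {λ i → V i q} {λ i → 1ℤ ℤ.* V i q} (λ i _ → sym (ℤ.*-identityˡ (V i q))))
  (trans (sym (weight-sum (λ _ → 1ℤ) q)) (ones q))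
  where
  ones : ∀ q → ∑ q (λ _ → 1ℤ) ≡ + q
  ones zero    = refl
  ones (suc q) = trans (cong (ℤ._+ 1ℤ) (ones q)) (cong +_ (+-comm q 1))

-- Each position carries exactly one of the five letters, so summing over the letters turns counts
-- into lengths.
balanced : ∀ q₁ q₂ q₃ → (∀ i → i < 5 → Δ i q₁ q₂ q₃ ≡ 0ℤ) → q₁ + q₃ ≡ q₂ + q₂
balanced q₁ q₂ q₃ h = ℤ.+-injective (begin
  + (q₁ + q₃)                                    ≡⟨ cong₂ ℤ._+_ (sym (V-total q₁)) (sym (V-total q₃)) ⟩
  ∑ 5 (λ i → V i q₁) ℤ.+ ∑ 5 (λ i → V i q₃)      ≡⟨ sym (∑-add 5 (λ i → V i q₁) (λ i → V i q₃)) ⟩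
  ∑ 5 (λ i → V i q₁ ℤ.+ V i q₃)
    ≡⟨ ∑-cong 5 {λ i → V i q₁ ℤ.+ V i q₃} {λ i → V i q₂ ℤ.+ V i q₂}
         (λ i i<5 → ℤ.i-j≡0⇒i≡j _ _ (h i i<5)) ⟩
  ∑ 5 (λ i → V i q₂ ℤ.+ V i q₂)                  ≡⟨ ∑-add 5 (λ i → V i q₂) (λ i → V i q₂) ⟩
  ∑ 5 (λ i → V i q₂) ℤ.+ ∑ 5 (λ i → V i q₂)      ≡⟨ cong₂ ℤ._+_ (V-total q₂) (V-total q₂) ⟩
  + (q₂ + q₂) ∎)
  where open ≡-Reasoning

infix 5 _==_
_==_ : ℤ → ℤ → Bool
+ m      == + n      = m ≡ᵇ n
-[1+ m ] == -[1+ n ] = m ≡ᵇ n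
_        == _        = false

==-sound : ∀ x y → x == y ≡ true → x ≡ y
==-sound (+ m)    (+ n)    e = cong +_ (≡ᵇ-sound e)
==-sound -[1+ m ] -[1+ n ] e = cong -[1+_] (≡ᵇ-sound e)

congruent : ∀ d .{{_ : NonZero d}} m n z → + m ≡ + n ℤ.+ + d ℤ.* z → m % d ≡ n % d
congruent d m n (+ k) e = trans (cong (_% d) (ℤ.+-injective
    (trans e (cong (ℤ._+_ (+ n)) (trans (sym (ℤ.pos-* d k)) (cong +_ (*-comm d k))))))) ([m+kn]%n≡m%n n k d)
congruent d m n -[1+ k ] e = sym (trans
  (cong (_% d) (ℤ.+-injective {n} {m + d * suc k}
    (trans (move (+ m) (+ n) (+ d ℤ.* + suc k)
             (trans e (cong (ℤ._+_ (+ n)) (sym (ℤ.neg-distribʳ-* (+ d) (+ suc k))))))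
           (cong (ℤ._+_ (+ m)) (sym (ℤ.pos-* d (suc k)))))))
  (trans (cong (λ t → (m + t) % d) (*-comm d (suc k))) ([m+kn]%n≡m%n m (suc k) d)))
  where
  move : ∀ x y t → x ≡ y ℤ.+ ℤ.- t → y ≡ x ℤ.+ t
  move x y t refl = lem y t
    where
    lem : ∀ y t → y ≡ y ℤ.+ ℤ.- t ℤ.+ t
    lem = solve-∀

-- Shifts of cut points, templates and one level of the descent

toℤ : Bool → ℤ
toℤ e = if e then 1ℤ else 0ℤ

toℕ : Bool → ℕ
toℕ e = if e then 1 else 0

V-shift : ∀ e i q → V i (q + toℕ e) ≡ V i q ℤ.+ toℤ e ℤ.* δ i (a q)
V-shift false i q = trans (cong (V i) (+-identityʳ q)) (lem (V i q) (δ i (a q)))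
  where
  lem : ∀ x y → x ≡ x ℤ.+ 0ℤ ℤ.* y
  lem = solve-∀
V-shift true  i q = trans (cong (V i) (+-comm q 1)) (lem (V i q) (δ i (a q)))
  where
  lem : ∀ x y → x ℤ.+ y ≡ x ℤ.+ 1ℤ ℤ.* y
  lem = solve-∀

-- Cached data of a cut point at offset `pos` in the block of `letter`. The list `single` serves the
-- outer cut points; `double` serves the middle one, which enters once at its offset and once `k`
-- further on.
record Entry : Set where
  constructor mk
  field
    letter pos : ℕ
    single double : List ℤ
    single-residues double-residues : List ℕ
    here-label middle-label : ℕ

record Template : Set where
  constructor template
  field
    t₁ t₂ t₃ : ℕ
    difference : List ℤ

  D : ℕ → ℤ
  D = nth 0ℤ difference

record Instance (τ : Template) (q₁ q₂ q₃ : ℕ) : Set where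
  constructor inst
  open Template τ
  field
    ordered₁  : q₁ ≤ q₂
    ordered₂  : q₂ ≤ q₃
    letter₁   : a q₁ ≡ t₁
    letter₂   : a q₂ ≡ t₂
    letter₃   : a q₃ ≡ t₃
    balance   : ∀ i → i < 5 → Δ i q₁ q₂ q₃ ≡ D i

bools : List Bool
bools = false ∷ true ∷ []

rows : ∀ d .{{_ : NonZero d}} → List ℕ → List ℕ → List ℕ → List ℕ → Bool
rows d (e ∷ es) (y ∷ ys) (x ∷ xs) (z ∷ zs) = ((e + y) % d ≡ᵇ (x + z) % d) ∧ rows d es ys xs zs
rows d _        _        _        _        = true

rows-complete : ∀ d .{{_ : NonZero d}} (e y x z : ℕ → ℕ) is →
  (∀ i → i ∈ is → (e i + y i) % d ≡ (x i + z i) % d) → rows d (map e is) (map y is) (map x is) (map z is) ≡ true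
rows-complete d e y x z []       h = refl
rows-complete d e y x z (i ∷ is) h
  rewrite ≡ᵇ-complete (h i (here refl)) = rows-complete d e y x z is (λ j j∈ → h j (there j∈))

-- A shift moves a cut point by at most one, whence the bound `suc q₃`; the descent for abelian
-- squares relies on it.
Outcome : List Template → ℕ → ℕ → ℕ → Set
Outcome τs q₁ q₂ q₃ =
  (∃[ u₁ ] ∃[ u₂ ] ∃[ u₃ ] (AbelianSquare u₁ u₂ u₃ × u₃ ≤ suc q₃)) ⊎
  (∃[ τ ] (τ ∈ τs × Instance τ q₁ q₂ q₃))

-- One reduction from positions `r + q * L` to block indices `q`, used for abelian squares of `a`,
-- for templates, and for `y`. A block of letter `b` contributes `d` to the sum of index `b` and 0
-- to the others. `ord` is the order of two offsets in the same block, the labels and `meets` carry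
-- what is known about letters at the cut points, and `candidates` lists the possible third offsets.
module Level
  (L k d : ℕ) {{_ : NonZero L}} {{_ : NonZero d}}
  (blk : ℕ → ℕ → ℕ → ℤ)
  (ord : ℕ → ℕ → Bool)
  (label label′ : ℕ → ℕ → ℕ)
  (meets : ℕ → ℕ → ℕ → Bool) (meets′ : ℕ → ℕ → Bool)
  (candidates : ℕ → ℕ → List ℕ)
  where

  pre : ℕ → ℕ → ℕ → ℤ
  pre i b r = ∑ r (blk i b)

  residue : ℤ → ℕ
  residue z = z ℤ.%ℕ d

  sums : List (List (List ℤ))
  sums = map (λ b → map (λ i → partial-sums (blk i b) 0ℤ 0 (L + k)) letters) letters

  sum-at : List (List (List ℤ)) → ℕ → ℕ → ℕ → ℤ
  sum-at σ i b r = nth 0ℤ (nth [] (nth [] σ b) i) r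

  sum-at-pre : ∀ i b r → i < 5 → b < 5 → r ≤ L + k → sum-at sums i b r ≡ pre i b r
  sum-at-pre i b r i<5 b<5 r≤ = trans
    (cong (λ σ → nth 0ℤ (nth [] σ i) r)
      (nth-map-upTo [] (λ b → map (λ i → partial-sums (blk i b) 0ℤ 0 (L + k)) letters) 5 b<5))
    (trans (cong (λ σ → nth 0ℤ σ r) (nth-map-upTo [] (λ i → partial-sums (blk i b) 0ℤ 0 (L + k)) 5 i<5))
      (trans (nth-partial-sums (blk i b) (L + k) 0 r r≤) (cong (λ n → ∑ n (blk i b)) (+-identityʳ r))))

  entry : List (List (List ℤ)) → ℕ → ℕ → Entry
  entry σ r b = mk b r (map (λ i → sum-at σ i b r) letters)
    (map (λ i → sum-at σ i b r ℤ.+ sum-at σ i b (r + k)) letters)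
    (map (λ i → residue (sum-at σ i b r)) letters)
    (map (λ i → residue (sum-at σ i b r ℤ.+ sum-at σ i b (r + k))) letters) (label b r) (label′ b r)

  row : List (List (List ℤ)) → ℕ → List Entry
  row σ r = map (entry σ r) letters

  table : List (List (List ℤ)) → List (List Entry)
  table σ = applyUpTo (row σ) L

  -- This is the value that the offsets and letters force upon `d` times `Δ`; `η` is the weighted
  -- deviation prescribed one level below.
  excess : (ℕ → ℤ) → (i b₁ r₁ b₂ r₂ b₃ r₃ : ℕ) → ℤ
  excess η i b₁ r₁ b₂ r₂ b₃ r₃ =
    η i ℤ.+ (pre i b₂ r₂ ℤ.+ pre i b₂ (r₂ + k)) ℤ.- (pre i b₁ r₁ ℤ.+ pre i b₃ r₃)

  excesses : (ℕ → ℤ) → List ℤ → List ℤ → List ℤ → List ℤ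
  excesses η S₂ S₁ S₃ = map (λ i → η i ℤ.+ nth 0ℤ S₂ i ℤ.- (nth 0ℤ S₁ i ℤ.+ nth 0ℤ S₃ i)) letters

  -- The change of `Δ` when each `q` with a true flag is increased by one. A square arises exactly
  -- when it cancels the computed value.
  shift : Bool → Bool → Bool → (b₁ b₂ b₃ : ℕ) → ℕ → ℤ
  shift e₁ e₂ e₃ b₁ b₂ b₃ i =
    toℤ e₁ ℤ.* δ i b₁ ℤ.+ toℤ e₃ ℤ.* δ i b₃ ℤ.- (toℤ e₂ ℤ.* δ i b₂ ℤ.+ toℤ e₂ ℤ.* δ i b₂)

  -- Necessary conditions for `q + e` and `q′ + e′` to coincide when `q ≤ q′`: equal shifts force
  -- the same block, hence the same letter and ordered offsets; otherwise only `q` moves, the blocks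
  -- are adjacent, and their letters form a `step`.
  link : Bool → Bool → (b r b′ r′ : ℕ) → Bool
  link e e′ b r b′ r′ = (toℕ e′ ≤ᵇ toℕ e) ∧ (if toℕ e ≡ᵇ toℕ e′ then (b ≡ᵇ b′) ∧ ord r r′ else step b b′)

  -- May the shifted cut points coincide, so that the abelian square is empty?
  collapses : Bool → Bool → Bool → (b₁ r₁ b₂ r₂ b₃ r₃ : ℕ) → Bool
  collapses e₁ e₂ e₃ b₁ r₁ b₂ r₂ b₃ r₃ = link e₁ e₂ b₁ r₁ b₂ r₂ ∧ link e₂ e₃ b₂ r₂ b₃ r₃

  is-square : List ℤ → (b₁ r₁ b₂ r₂ b₃ r₃ : ℕ) → Bool → Bool → Bool → Bool
  is-square X b₁ r₁ b₂ r₂ b₃ r₃ e₁ e₂ e₃ =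
    all (λ i → nth 0ℤ X i == + d ℤ.* (ℤ.- shift e₁ e₂ e₃ b₁ b₂ b₃ i)) letters
    ∧ not (collapses e₁ e₂ e₃ b₁ r₁ b₂ r₂ b₃ r₃)

  is-instance : List ℤ → (b₁ b₂ b₃ : ℕ) → Template → Bool
  is-instance X b₁ b₂ b₃ τ@(template t₁ t₂ t₃ _) =
    (b₁ ≡ᵇ t₁) ∧ (b₂ ≡ᵇ t₂) ∧ (b₃ ≡ᵇ t₃) ∧ all (λ i → nth 0ℤ X i == + d ℤ.* Template.D τ i) letters

  exact : List Template → List ℤ → (b₁ r₁ b₂ r₂ b₃ r₃ : ℕ) → Bool
  exact τs X b₁ r₁ b₂ r₂ b₃ r₃ =
    any (λ e₁ → any (λ e₂ → any (λ e₃ → is-square X b₁ r₁ b₂ r₂ b₃ r₃ e₁ e₂ e₃) bools) bools) bools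
    ∨ any (is-instance X b₁ b₂ b₃) τs

  test : List Template → (ℕ → ℤ) → List ℕ → Entry → Entry → Entry → Bool
  test τs η ηs (mk b₁ r₁ S₁ _ s₁ _ _ _) (mk b₂ r₂ _ S₂ _ s₂ _ _) (mk b₃ r₃ S₃ _ s₃ _ _ _) =
    if rows d ηs s₂ s₁ s₃ then exact τs (excesses η S₂ S₁ S₃) b₁ r₁ b₂ r₂ b₃ r₃ else true

  test-rows : List Template → (ℕ → ℤ) → List ℕ → List Entry → List Entry → List Entry → Bool
  test-rows τs η ηs R₁ R₂ R₃ =
    all (λ E₁ → all (λ E₂ →
      if meets (Entry.here-label E₁) (Entry.here-label E₂) (Entry.middle-label E₂)
      then all (λ E₃ → if meets′ (Entry.here-label E₂) (Entry.here-label E₃)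
                       then test τs η ηs E₁ E₂ E₃ else true) R₃
      else true) R₂) R₁

  -- The table is an argument so that its evaluation is shared by all triples of offsets.
  check-with : List (List Entry) → List Template → (ℕ → ℤ) → List ℕ → Bool
  check-with tab τs η ηs = all (λ r₁ → all (λ r₂ → all (λ r₃ →
    test-rows τs η ηs (nth [] tab r₁) (nth [] tab r₂) (nth [] tab r₃)) (candidates r₁ r₂)) (upTo L)) (upTo L)

  check : List Template → (ℕ → ℤ) → Bool
  check τs η = check-with (table sums) τs η (map (λ i → residue (η i)) letters)

  residue-split : ∀ z → ∃[ w ] + residue z ≡ z ℤ.- + d ℤ.* w
  residue-split z = z ℤ./ℕ d , trans (lem (+ residue z) (z ℤ./ℕ d) (+ d))
    (cong (ℤ._- + d ℤ.* (z ℤ./ℕ d)) (sym (ℤ.a≡a%ℕn+[a/ℕn]*n z d)))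
    where
    lem : ∀ r w e → r ≡ r ℤ.+ w ℤ.* e ℤ.- e ℤ.* w
    lem = solve-∀

  module _ (τs : List Template) (η : ℕ → ℤ) (ok : check τs η ≡ true)
    (q₁ q₂ q₃ r₁ r₂ r₃ : ℕ) (q₁≤q₂ : q₁ ≤ q₂) (q₂≤q₃ : q₂ ≤ q₃)
    (r₁<L : r₁ < L) (r₂<L : r₂ < L) (r₃<L : r₃ < L) (r₃∈ : r₃ ∈ candidates r₁ r₂)
    (ord₁ : q₁ ≡ q₂ → ord r₁ r₂ ≡ true) (ord₂ : q₂ ≡ q₃ → ord r₂ r₃ ≡ true)
    (meet : meets (label (a q₁) r₁) (label (a q₂) r₂) (label′ (a q₂) r₂) ≡ true)
    (meet′ : meets′ (label (a q₂) r₂) (label (a q₃) r₃) ≡ true)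
    (equation : ∀ i → i < 5 → + d ℤ.* Δ i q₁ q₂ q₃ ≡ excess η i (a q₁) r₁ (a q₂) r₂ (a q₃) r₃)
    where

    E₁ = entry sums r₁ (a q₁)
    E₂ = entry sums r₂ (a q₂)
    E₃ = entry sums r₃ (a q₃)

    single₁ double₂ single₃ : ℕ → ℤ
    single₁ i = sum-at sums i (a q₁) r₁
    double₂ i = sum-at sums i (a q₂) r₂ ℤ.+ sum-at sums i (a q₂) (r₂ + k)
    single₃ i = sum-at sums i (a q₃) r₃

    equation′ : ∀ i → i < 5 → + d ℤ.* Δ i q₁ q₂ q₃ ≡ η i ℤ.+ double₂ i ℤ.- (single₁ i ℤ.+ single₃ i)
    equation′ i i<5 = trans (equation i i<5) (cong₂ (λ s t → η i ℤ.+ s ℤ.- t)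
      (cong₂ ℤ._+_ (sym (sum-at-pre i (a q₂) r₂ i<5 (a<5 q₂) (≤-trans (<⇒≤ r₂<L) (m≤m+n L k))))
                   (sym (sum-at-pre i (a q₂) (r₂ + k) i<5 (a<5 q₂) (+-monoˡ-≤ k (<⇒≤ r₂<L)))))
      (cong₂ ℤ._+_ (sym (sum-at-pre i (a q₁) r₁ i<5 (a<5 q₁) (≤-trans (<⇒≤ r₁<L) (m≤m+n L k))))
                   (sym (sum-at-pre i (a q₃) r₃ i<5 (a<5 q₃) (≤-trans (<⇒≤ r₃<L) (m≤m+n L k))))))

    X : List ℤ
    X = excesses η (map double₂ letters) (map single₁ letters) (map single₃ letters)

    equation″ : ∀ i → i < 5 → + d ℤ.* Δ i q₁ q₂ q₃ ≡ nth 0ℤ X i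
    equation″ i i<5 = trans (equation′ i i<5) (sym (trans
      (nth-map-upTo 0ℤ (λ i → η i ℤ.+ nth 0ℤ (map double₂ letters) i
                               ℤ.- (nth 0ℤ (map single₁ letters) i ℤ.+ nth 0ℤ (map single₃ letters) i)) 5 i<5)
      (cong₂ (λ s t → η i ℤ.+ s ℤ.- t) (nth-map-upTo 0ℤ double₂ 5 i<5)
        (cong₂ ℤ._+_ (nth-map-upTo 0ℤ single₁ 5 i<5) (nth-map-upTo 0ℤ single₃ 5 i<5)))))

    -- `Δ` is an integer, so the forced value of `d` times `Δ` is divisible by `d`. Replacing all
    -- terms by their residues changes the equation only by multiples of `d`.
    rows-agree : ∀ i → i ∈ letters →
      (residue (η i) + residue (double₂ i)) % d ≡ (residue (single₁ i) + residue (single₃ i)) % d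
    rows-agree i i∈ =
      congruent d (residue (η i) + residue (double₂ i)) (residue (single₁ i) + residue (single₃ i))
        (Δ i q₁ q₂ q₃ ℤ.- w₀ ℤ.- w₂ ℤ.+ w₁ ℤ.+ w₃)
        (trans (cong₂ ℤ._+_ (proj₂ (residue-split (η i))) (proj₂ (residue-split (double₂ i)))) (trans
          (lem (η i) (double₂ i) (single₁ i) (single₃ i) (Δ i q₁ q₂ q₃) w₀ w₂ w₁ w₃ (+ d)
            (equation′ i (∈-upTo⁻ i∈)))
          (cong (ℤ._+ + d ℤ.* (Δ i q₁ q₂ q₃ ℤ.- w₀ ℤ.- w₂ ℤ.+ w₁ ℤ.+ w₃))
            (cong₂ ℤ._+_ (sym (proj₂ (residue-split (single₁ i)))) (sym (proj₂ (residue-split (single₃ i))))))))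
      where
      w₀ = proj₁ (residue-split (η i))
      w₂ = proj₁ (residue-split (double₂ i))
      w₁ = proj₁ (residue-split (single₁ i))
      w₃ = proj₁ (residue-split (single₃ i))
      ring₁ : ∀ n y w₀ w₂ e →
        (n ℤ.- e ℤ.* w₀) ℤ.+ (y ℤ.- e ℤ.* w₂) ≡ (n ℤ.+ y) ℤ.- (e ℤ.* w₀ ℤ.+ e ℤ.* w₂)
      ring₁ = solve-∀
      ring₂ : ∀ n y x z → n ℤ.+ y ≡ (n ℤ.+ y ℤ.- (x ℤ.+ z)) ℤ.+ (x ℤ.+ z)
      ring₂ = solve-∀
      ring₃ : ∀ v x z w₀ w₂ w₁ w₃ e →
        (e ℤ.* v ℤ.+ (x ℤ.+ z)) ℤ.- (e ℤ.* w₀ ℤ.+ e ℤ.* w₂)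
          ≡ ((x ℤ.- e ℤ.* w₁) ℤ.+ (z ℤ.- e ℤ.* w₃)) ℤ.+ e ℤ.* (v ℤ.- w₀ ℤ.- w₂ ℤ.+ w₁ ℤ.+ w₃)
      ring₃ = solve-∀
      lem : ∀ n y x z v w₀ w₂ w₁ w₃ e → e ℤ.* v ≡ n ℤ.+ y ℤ.- (x ℤ.+ z) →
        (n ℤ.- e ℤ.* w₀) ℤ.+ (y ℤ.- e ℤ.* w₂)
          ≡ ((x ℤ.- e ℤ.* w₁) ℤ.+ (z ℤ.- e ℤ.* w₃)) ℤ.+ e ℤ.* (v ℤ.- w₀ ℤ.- w₂ ℤ.+ w₁ ℤ.+ w₃)
      lem n y x z v w₀ w₂ w₁ w₃ e eq = trans (ring₁ n y w₀ w₂ e) (trans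
        (cong (ℤ._- (e ℤ.* w₀ ℤ.+ e ℤ.* w₂)) (trans (ring₂ n y x z) (cong (ℤ._+ (x ℤ.+ z)) (sym eq))))
        (ring₃ v x z w₀ w₂ w₁ w₃ e))

    if-true : ∀ {A : Set} {c : Bool} {x y : A} → c ≡ true → (if c then x else y) ≡ x
    if-true refl = refl

    entry∈ : ∀ {r} q → r < L → entry sums r (a q) ∈ nth [] (table sums) r
    entry∈ {r} q r<L rewrite nth-applyUpTo [] (row sums) r<L = ∈-map⁺ (entry sums r) (∈-upTo⁺ (a<5 q))

    exact-holds : exact τs X (a q₁) r₁ (a q₂) r₂ (a q₃) r₃ ≡ true
    exact-holds = trans (sym (if-true (rows-complete d (λ i → residue (η i)) (λ i → residue (double₂ i))
        (λ i → residue (single₁ i)) (λ i → residue (single₃ i)) letters rows-agree))) test-holds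
      where
      ηs = map (λ i → residue (η i)) letters
      at-r : test-rows τs η ηs (nth [] (table sums) r₁) (nth [] (table sums) r₂) (nth [] (table sums) r₃) ≡ true
      at-r = all-sound (λ r₃ → test-rows τs η ηs (nth [] (table sums) r₁) (nth [] (table sums) r₂) (nth [] (table sums) r₃))
        (candidates r₁ r₂)
        (all-upTo {L} (λ r₂ → all (λ r₃ → test-rows τs η ηs (nth [] (table sums) r₁) (nth [] (table sums) r₂) (nth [] (table sums) r₃))
                                (candidates r₁ r₂))
          (all-upTo {L} (λ r₁ → all (λ r₂ → all (λ r₃ →
              test-rows τs η ηs (nth [] (table sums) r₁) (nth [] (table sums) r₂) (nth [] (table sums) r₃)) (candidates r₁ r₂)) (upTo L))
            ok r₁<L) r₂<L) r₃∈
      at-12 = all-sound _ (nth [] (table sums) r₂) (all-sound _ (nth [] (table sums) r₁) at-r (entry∈ q₁ r₁<L)) (entry∈ q₂ r₂<L)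
      at-3 = all-sound _ (nth [] (table sums) r₃) (trans (sym (if-true meet)) at-12) (entry∈ q₃ r₃<L)
      test-holds : test τs η ηs E₁ E₂ E₃ ≡ true
      test-holds = trans (sym (if-true meet′)) at-3

    link-complete : ∀ e e′ {q q′ r r′} → q ≤ q′ → q + toℕ e ≡ q′ + toℕ e′ →
      (q ≡ q′ → ord r r′ ≡ true) → link e e′ (a q) r (a q′) r′ ≡ true
    link-complete false false {q} {q′} le eq o
      with refl ← +-cancelʳ-≡ 0 q q′ eq rewrite ≡ᵇ-complete {a q} refl = o refl
    link-complete true true {q} {q′} le eq o
      with refl ← +-cancelʳ-≡ 1 q q′ eq rewrite ≡ᵇ-complete {a q} refl = o refl
    link-complete true false {q} {q′} le eq o
      with refl ← trans (sym (+-comm q 1)) (trans eq (+-identityʳ q′)) = a-step q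
    link-complete false true {q} {q′} le eq o =
      contradiction (≤-trans (≤-reflexive (trans (+-comm 1 q′) (trans (sym eq) (+-identityʳ q)))) le) (<-irrefl refl)

    d≢0 : ℤ.NonZero (+ d)
    d≢0 = record { nonZero = NonZero.nonZero it }

    cancel : ∀ x y → + d ℤ.* x ≡ + d ℤ.* y → x ≡ y
    cancel x y = ℤ.*-cancelˡ-≡ (+ d) x y {{d≢0}}

    square-outcome : ∀ e₁ e₂ e₃ → is-square X (a q₁) r₁ (a q₂) r₂ (a q₃) r₃ e₁ e₂ e₃ ≡ true → Outcome τs q₁ q₂ q₃
    square-outcome e₁ e₂ e₃ ok with eqs , nc ← ∧-split ok = decide (<-cmp u₁ u₂)
      where
      u₁ = q₁ + toℕ e₁
      u₂ = q₂ + toℕ e₂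
      u₃ = q₃ + toℕ e₃
      toℕ≤1 : ∀ e → toℕ e ≤ 1
      toℕ≤1 false = z≤n
      toℕ≤1 true  = ≤-refl
      zeroes : ∀ i → i < 5 → Δ i u₁ u₂ u₃ ≡ 0ℤ
      zeroes i i<5 = trans (cong₂ ℤ._-_ (cong₂ ℤ._+_ (V-shift e₁ i q₁) (V-shift e₃ i q₃))
          (cong₂ ℤ._+_ (V-shift e₂ i q₂) (V-shift e₂ i q₂)))
        (lem (V i q₁) (V i q₂) (V i q₃) _ _ _
          (cancel _ _ (trans (equation″ i i<5) (==-sound _ _ (all-upTo {5}
            (λ i → nth 0ℤ X i
                     == + d ℤ.* (ℤ.- shift e₁ e₂ e₃ (a q₁) (a q₂) (a q₃) i)) eqs i<5)))))
        where
        ring : ∀ x y z s t w → (x ℤ.+ s) ℤ.+ (z ℤ.+ w) ℤ.- ((y ℤ.+ t) ℤ.+ (y ℤ.+ t))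
          ≡ (x ℤ.+ z ℤ.- (y ℤ.+ y)) ℤ.+ (s ℤ.+ w ℤ.- (t ℤ.+ t))
        ring = solve-∀
        lem : ∀ x y z s t w → x ℤ.+ z ℤ.- (y ℤ.+ y) ≡ ℤ.- (s ℤ.+ w ℤ.- (t ℤ.+ t)) →
          (x ℤ.+ s) ℤ.+ (z ℤ.+ w) ℤ.- ((y ℤ.+ t) ℤ.+ (y ℤ.+ t)) ≡ 0ℤ
        lem x y z s t w eq = trans (ring x y z s t w)
          (trans (cong (ℤ._+ (s ℤ.+ w ℤ.- (t ℤ.+ t))) eq) (ℤ.+-inverseˡ (s ℤ.+ w ℤ.- (t ℤ.+ t))))
      middle : u₁ + u₃ ≡ u₂ + u₂
      middle = balanced u₁ u₂ u₃ zeroes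
      -- The shifted cut points are equidistant by `middle`, so comparing the first two determines
      -- the order of all three.
      decide : Tri (u₁ < u₂) (u₁ ≡ u₂) (u₂ < u₁) → Outcome τs q₁ q₂ q₃
      decide (tri< u₁<u₂ _ _) = inj₁ (u₁ , u₂ , u₃ , (u₁<u₂ , +-cancelˡ-< u₁ u₂ u₃ (begin-strict
          u₁ + u₂ <⟨ +-monoˡ-< u₂ u₁<u₂ ⟩
          u₂ + u₂ ≡⟨ sym middle ⟩
          u₁ + u₃ ∎) , zeroes) ,
          (begin u₃ ≤⟨ +-monoʳ-≤ q₃ (toℕ≤1 e₃) ⟩ q₃ + 1 ≡⟨ +-comm q₃ 1 ⟩ suc q₃ ∎))
        where open ≤-Reasoning
      decide (tri≈ _ u₁≡u₂ _) = contradiction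
        (trans (sym nc) (cong not (both (link-complete e₁ e₂ q₁≤q₂ u₁≡u₂ ord₁) (link-complete e₂ e₃ q₂≤q₃ u₂≡u₃ ord₂))))
        (λ ())
        where
        both : ∀ {x y} → x ≡ true → y ≡ true → x ∧ y ≡ true
        both refl refl = refl
        u₂≡u₃ : u₂ ≡ u₃
        u₂≡u₃ = +-cancelˡ-≡ u₁ u₂ u₃ (trans (cong (_+ u₂) u₁≡u₂) (sym middle))
      -- Overtaking forces `u₂ ≤ q₂`, because `u₁` exceeds `q₂` by at most one. Then `u₂ ≤ q₃ ≤ u₃`,
      -- while equidistance puts `u₃` before `u₂`.
      decide (tri> _ _ u₂<u₁) = contradiction (begin-strict
          u₃ <⟨ u₃<u₂ ⟩
          u₂ ≤⟨ ≤-pred (≤-trans u₂<u₁ u₁≤1+q₂) ⟩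
          q₂ ≤⟨ q₂≤q₃ ⟩
          q₃ ≤⟨ m≤m+n q₃ (toℕ e₃) ⟩
          u₃ ∎) (<-irrefl refl)
        where
        open ≤-Reasoning
        u₁≤1+q₂ : u₁ ≤ suc q₂
        u₁≤1+q₂ = ≤-trans (+-mono-≤ q₁≤q₂ (toℕ≤1 e₁)) (≤-reflexive (+-comm q₂ 1))
        u₃<u₂ : u₃ < u₂
        u₃<u₂ = +-cancelˡ-< u₁ u₃ u₂ (begin-strict
          u₁ + u₃ ≡⟨ middle ⟩
          u₂ + u₂ <⟨ +-monoˡ-< u₂ u₂<u₁ ⟩
          u₁ + u₂ ∎)

    instance-outcome : ∀ τ → τ ∈ τs → is-instance X (a q₁) (a q₂) (a q₃) τ ≡ true → Outcome τs q₁ q₂ q₃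
    instance-outcome τ τ∈ ok
      with l₁ , ok ← ∧-split {a q₁ ≡ᵇ Template.t₁ τ} ok
      with l₂ , ok ← ∧-split {a q₂ ≡ᵇ Template.t₂ τ} ok
      with l₃ , eqs ← ∧-split {a q₃ ≡ᵇ Template.t₃ τ} ok =
      inj₂ (τ , τ∈ , inst q₁≤q₂ q₂≤q₃ (≡ᵇ-sound l₁) (≡ᵇ-sound l₂) (≡ᵇ-sound l₃)
        (λ i i<5 → cancel _ _ (trans (equation″ i i<5) (==-sound _ _ (all-upTo {5}
          (λ i → nth 0ℤ X i == + d ℤ.* Template.D τ i) eqs i<5)))))

    squares-found : Bool
    squares-found = any (λ e₁ → any (λ e₂ → any (λ e₃ →
      is-square X (a q₁) r₁ (a q₂) r₂ (a q₃) r₃ e₁ e₂ e₃) bools) bools) bools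

    square-found-outcome : squares-found ≡ true → Outcome τs q₁ q₂ q₃
    square-found-outcome e =
      let e₁ , _ , p₁ = any-sound (λ e₁ → any (λ e₂ → any (λ e₃ →
                          is-square X (a q₁) r₁ (a q₂) r₂ (a q₃) r₃ e₁ e₂ e₃) bools) bools) bools e
          e₂ , _ , p₂ = any-sound (λ e₂ → any (λ e₃ →
                          is-square X (a q₁) r₁ (a q₂) r₂ (a q₃) r₃ e₁ e₂ e₃) bools) bools p₁
          e₃ , _ , p₃ = any-sound (λ e₃ → is-square X (a q₁) r₁ (a q₂) r₂ (a q₃) r₃ e₁ e₂ e₃) bools p₂
      in square-outcome e₁ e₂ e₃ p₃

    instance-found-outcome : any (is-instance X (a q₁) (a q₂) (a q₃)) τs ≡ true → Outcome τs q₁ q₂ q₃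
    instance-found-outcome e =
      let τ , τ∈ , h = any-sound (is-instance X (a q₁) (a q₂) (a q₃)) τs e in instance-outcome τ τ∈ h

    outcome : Outcome τs q₁ q₂ q₃
    outcome = either square-found-outcome instance-found-outcome exact-holds
      where
      either : ∀ {x z} {A : Set} → (x ≡ true → A) → (z ≡ true → A) → x ∨ z ≡ true → A
      either {true}  f g e = f refl
      either {false} f g e = g e

-- The positions satisfy a linear relation, so the third offset is `2 r₂ + k − r₁` modulo `L`;
-- writing `L ∸ r₁` for `−r₁` keeps the computation in the naturals, and the extra 1 in the number
-- of blocks pays for that `L`.
next-candidate : ∀ L .{{_ : NonZero L}} k {q₁ q₂ q₃ r₁ r₂ r₃} → r₁ < L → r₃ < L →
  (r₁ + q₁ * L) + (r₃ + q₃ * L) ≡ (r₂ + q₂ * L) + (r₂ + q₂ * L + k) →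
  r₃ ≡ (r₂ + r₂ + k + (L ∸ r₁)) % L
next-candidate L k {q₁} {q₂} {q₃} {r₁} {r₂} {r₃} r₁<L r₃<L eq = begin
  r₃                                                 ≡⟨ sym (m<n⇒m%n≡m r₃<L) ⟩
  r₃ % L                                             ≡⟨ sym ([m+kn]%n≡m%n r₃ (q₁ + q₃ + 1) L) ⟩
  (r₃ + (q₁ + q₃ + 1) * L) % L                       ≡⟨ cong (_% L) whole ⟩
  (r₂ + r₂ + k + (L ∸ r₁) + (q₂ + q₂) * L) % L       ≡⟨ [m+kn]%n≡m%n (r₂ + r₂ + k + (L ∸ r₁)) (q₂ + q₂) L ⟩
  (r₂ + r₂ + k + (L ∸ r₁)) % L                       ∎
  where
  open ≡-Reasoning
  whole : r₃ + (q₁ + q₃ + 1) * L ≡ r₂ + r₂ + k + (L ∸ r₁) + (q₂ + q₂) * L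
  whole = trans (left r₃ q₁ q₃ L) (trans
    (cong (λ t → r₃ + (q₁ * L + q₃ * L) + t) (sym (m+[n∸m]≡n (<⇒≤ r₁<L))))
    (trans (shuffle r₁ r₃ (q₁ * L) (q₃ * L) (L ∸ r₁)) (trans (cong (_+ (L ∸ r₁)) eq)
      (right r₂ q₂ L k (L ∸ r₁)))))
    where
    left : ∀ r q p m → r + (q + p + 1) * m ≡ r + (q * m + p * m) + m
    left = ℕ.solve-∀
    shuffle : ∀ r s x y z → s + (x + y) + (r + z) ≡ (r + x) + (s + y) + z
    shuffle = ℕ.solve-∀
    right : ∀ r q m k z → (r + q * m) + (r + q * m + k) + z ≡ r + r + k + z + (q + q) * m
    right = ℕ.solve-∀

<ᵇ-complete : ∀ {m n} → m < n → (m <ᵇ n) ≡ true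
<ᵇ-complete m<n = Equivalence.to T-≡ (<⇒<ᵇ m<n)

≤ᵇ-complete : ∀ {m n} → m ≤ n → (m ≤ᵇ n) ≡ true
≤ᵇ-complete m≤n = Equivalence.to T-≡ (≤⇒≤ᵇ m≤n)

-- Weights for the substitution on five letters

check-letters : (p : ℕ → ℕ → Bool) → all (λ i → all (p i) letters) letters ≡ true →
  ∀ i b → i < 5 → b < 5 → p i b ≡ true
check-letters p e i b i<5 b<5 = all-upTo {5} (p i) (all-upTo {5} (λ i → all (p i) letters) e i<5) b<5

-- 176 times the inverse of the incidence matrix of the substitution.
adjugate : List (List ℤ)
adjugate =
  (+ 47 ∷ -[1+ 16 ] ∷ -[1+ 0 ] ∷ -[1+ 0 ] ∷ -[1+ 16 ] ∷ []) ∷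
  (-[1+ 16 ] ∷ + 47 ∷ -[1+ 16 ] ∷ -[1+ 0 ] ∷ -[1+ 0 ] ∷ []) ∷
  (-[1+ 0 ] ∷ -[1+ 16 ] ∷ + 47 ∷ -[1+ 16 ] ∷ -[1+ 0 ] ∷ []) ∷
  (-[1+ 0 ] ∷ -[1+ 0 ] ∷ -[1+ 16 ] ∷ + 47 ∷ -[1+ 16 ] ∷ []) ∷
  (-[1+ 16 ] ∷ -[1+ 0 ] ∷ -[1+ 0 ] ∷ -[1+ 16 ] ∷ + 47 ∷ []) ∷ []

weight : ℕ → ℕ → ℤ
weight i c = nth 0ℤ (nth [] adjugate i) c

outer-block : ℕ → ℕ → ℕ → ℤ
outer-block i b r = weight i ((b + f₀ r) % 5)

-- The incidence matrix is the circulant with first row 6, 3, 2, 2, 3. Its eigenvalues are 16 and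
-- two double ones with product 11, whence the denominator 176 = 16 · 11.
outer-sum : ∀ i b → i < 5 → b < 5 → ∑ 16 (outer-block i b) ≡ + 176 ℤ.* δ i b
outer-sum i b i<5 b<5 = ==-sound (∑ 16 (outer-block i b)) (+ 176 ℤ.* δ i b)
  (check-letters (λ i b → ∑ 16 (outer-block i b) == + 176 ℤ.* δ i b) refl i b i<5 b<5)

-- A deviation `D` of the letter counts one level below enters the equation for the blocks through
-- this weighted sum; it takes the place of `η`.
weigh : (ℕ → ℤ) → ℕ → ℤ
weigh D i = ∑ 5 (λ c → weight i c ℤ.* D c)

outer-split : ∀ i q r → i < 5 → r ≤ 16 →
  ∑ (r + q * 16) (λ j → weight i (a j)) ≡ + 176 ℤ.* V i q ℤ.+ ∑ r (outer-block i (a q))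
outer-split i q r i<5 r≤16 = ∑-block-offset 16 16 (+ 176) (λ j → weight i (a j)) (outer-block i) i i<5
  (λ q r r<16 → cong (weight i) (a-block q r r<16)) ≤-refl (λ b b<5 → outer-sum i b i<5 b<5) q r r≤16

weighted-Δ : ∀ i u₁ u₂ u₃ (D : ℕ → ℤ) → (∀ c → c < 5 → Δ c u₁ u₂ u₃ ≡ D c) →
  let S = λ u → ∑ u (λ j → weight i (a j)) in
  S u₁ ℤ.+ S u₃ ≡ S u₂ ℤ.+ S u₂ ℤ.+ weigh D i
weighted-Δ i u₁ u₂ u₃ D h = begin
  S u₁ ℤ.+ S u₃                              ≡⟨ cong₂ ℤ._+_ (weight-sum w u₁) (weight-sum w u₃) ⟩
  ∑ 5 (wV u₁) ℤ.+ ∑ 5 (wV u₃)                ≡⟨ sym (∑-add 5 (wV u₁) (wV u₃)) ⟩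
  ∑ 5 (λ c → wV u₁ c ℤ.+ wV u₃ c)            ≡⟨ ∑-cong 5 {λ c → wV u₁ c ℤ.+ wV u₃ c}
                                                  {λ c → wV u₂ c ℤ.+ wV u₂ c ℤ.+ w c ℤ.* D c}
                                                  (λ c c<5 → point (w c) (V c u₁) (V c u₂) (V c u₃) (D c) (h c c<5)) ⟩
  ∑ 5 (λ c → wV u₂ c ℤ.+ wV u₂ c ℤ.+ w c ℤ.* D c)
    ≡⟨ ∑-add 5 (λ c → wV u₂ c ℤ.+ wV u₂ c) (λ c → w c ℤ.* D c) ⟩
  ∑ 5 (λ c → wV u₂ c ℤ.+ wV u₂ c) ℤ.+ weigh D i
    ≡⟨ cong (ℤ._+ weigh D i) (trans (∑-add 5 (wV u₂) (wV u₂)) (cong₂ ℤ._+_ (sym (weight-sum w u₂)) (sym (weight-sum w u₂)))) ⟩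
  S u₂ ℤ.+ S u₂ ℤ.+ weigh D i                ∎
  where
  open ≡-Reasoning
  w = weight i
  S : ℕ → ℤ
  S u = ∑ u (λ j → w (a j))
  wV : ℕ → ℕ → ℤ
  wV u c = w c ℤ.* V c u
  point : ∀ w x y z t → x ℤ.+ z ℤ.- (y ℤ.+ y) ≡ t → w ℤ.* x ℤ.+ w ℤ.* z ≡ w ℤ.* y ℤ.+ w ℤ.* y ℤ.+ w ℤ.* t
  point w x y z _ refl = ring w x y z
    where
    ring : ∀ w x y z → w ℤ.* x ℤ.+ w ℤ.* z ≡ w ℤ.* y ℤ.+ w ℤ.* y ℤ.+ w ℤ.* (x ℤ.+ z ℤ.- (y ℤ.+ y))
    ring = solve-∀

combine : ∀ P₁ P₂ P₂′ P₃ d v₁ v₂ v₃ p₁ p₂ p₂′ p₃ η →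
  P₁ ≡ d ℤ.* v₁ ℤ.+ p₁ → P₂ ≡ d ℤ.* v₂ ℤ.+ p₂ → P₂′ ≡ d ℤ.* v₂ ℤ.+ p₂′ → P₃ ≡ d ℤ.* v₃ ℤ.+ p₃ →
  P₁ ℤ.+ P₃ ≡ P₂ ℤ.+ P₂′ ℤ.+ η →
  d ℤ.* (v₁ ℤ.+ v₃ ℤ.- (v₂ ℤ.+ v₂)) ≡ η ℤ.+ (p₂ ℤ.+ p₂′) ℤ.- (p₁ ℤ.+ p₃)
combine _ _ _ _ d v₁ v₂ v₃ p₁ p₂ p₂′ p₃ η refl refl refl refl eq =
  trans (ring₁ d v₁ v₂ v₃ p₁ p₃) (trans (cong (λ s → s ℤ.- (p₁ ℤ.+ p₃) ℤ.- d ℤ.* (v₂ ℤ.+ v₂)) eq)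
    (ring₂ d v₂ p₁ p₂ p₂′ p₃ η))
  where
  ring₁ : ∀ d v₁ v₂ v₃ p₁ p₃ → d ℤ.* (v₁ ℤ.+ v₃ ℤ.- (v₂ ℤ.+ v₂))
    ≡ (d ℤ.* v₁ ℤ.+ p₁) ℤ.+ (d ℤ.* v₃ ℤ.+ p₃) ℤ.- (p₁ ℤ.+ p₃) ℤ.- d ℤ.* (v₂ ℤ.+ v₂)
  ring₁ = solve-∀
  ring₂ : ∀ d v₂ p₁ p₂ p₂′ p₃ η →
    (d ℤ.* v₂ ℤ.+ p₂) ℤ.+ (d ℤ.* v₂ ℤ.+ p₂′) ℤ.+ η ℤ.- (p₁ ℤ.+ p₃) ℤ.- d ℤ.* (v₂ ℤ.+ v₂)
    ≡ η ℤ.+ (p₂ ℤ.+ p₂′) ℤ.- (p₁ ℤ.+ p₃)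
  ring₂ = solve-∀

outer-equation : ∀ q₁ q₂ q₃ r₁ r₂ r₃ → r₁ < 16 → r₂ < 16 → r₃ < 16 → (D : ℕ → ℤ) →
  (∀ c → c < 5 → Δ c (r₁ + q₁ * 16) (r₂ + q₂ * 16) (r₃ + q₃ * 16) ≡ D c) →
  ∀ i → i < 5 → + 176 ℤ.* Δ i q₁ q₂ q₃ ≡
    weigh D i ℤ.+ (∑ r₂ (outer-block i (a q₂)) ℤ.+ ∑ (r₂ + 0) (outer-block i (a q₂)))
      ℤ.- (∑ r₁ (outer-block i (a q₁)) ℤ.+ ∑ r₃ (outer-block i (a q₃)))
outer-equation q₁ q₂ q₃ r₁ r₂ r₃ r₁< r₂< r₃< D h i i<5 rewrite +-identityʳ r₂ =
  combine (S (r₁ + q₁ * 16)) (S (r₂ + q₂ * 16)) (S (r₂ + q₂ * 16)) (S (r₃ + q₃ * 16)) (+ 176) (V i q₁) (V i q₂) (V i q₃)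
    (∑ r₁ (outer-block i (a q₁))) (∑ r₂ (outer-block i (a q₂))) (∑ r₂ (outer-block i (a q₂)))
    (∑ r₃ (outer-block i (a q₃))) (weigh D i)
    (outer-split i q₁ r₁ i<5 (<⇒≤ r₁<)) (outer-split i q₂ r₂ i<5 (<⇒≤ r₂<))
    (outer-split i q₂ r₂ i<5 (<⇒≤ r₂<)) (outer-split i q₃ r₃ i<5 (<⇒≤ r₃<))
    (weighted-Δ i (r₁ + q₁ * 16) (r₂ + q₂ * 16) (r₃ + q₃ * 16) D h)
  where
  S : ℕ → ℤ
  S u = ∑ u (λ j → weight i (a j))

offset-< : ∀ L q {r s} → r + q * L < s + q * L → r < s
offset-< L q {r} {s} lt = +-cancelʳ-< (q * L) r s lt

-- The word on five letters has no abelian squares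

module Squares = Level 16 0 176 outer-block _<ᵇ_ (λ _ _ → 0) (λ _ _ → 0)
  (λ _ _ _ → true) (λ _ _ → true) (λ r₁ r₂ → (r₂ + r₂ + 0 + (16 ∸ r₁)) % 16 ∷ [])

-- With no templates allowed, every surviving case must yield a nonempty abelian square after
-- shifting the block indices.
squares-check : Squares.check [] (weigh (λ _ → 0ℤ)) ≡ true
squares-check = refl

-- The added one accounts for the shift of the last cut point. A square has three distinct cut
-- points, so the last is at least 2.
suc[n/16]<n : ∀ n → 2 ≤ n → suc (n / 16) < n
suc[n/16]<n n 2≤n with n / 16 | m/n*n≤m n 16
... | zero  | _  = 2≤n
... | suc q | le = ≤-trans (s≤s (s≤s (s≤s (≤-trans (m≤m*n q 16) (m≤n+m (q * 16) 13))))) le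

Δ-cong : ∀ c {x x′ y y′ z z′ w} → x ≡ x′ → y ≡ y′ → z ≡ z′ → Δ c x y z ≡ w → Δ c x′ y′ z′ ≡ w
Δ-cong c refl refl refl e = e

module _ (u₁ u₂ u₃ : ℕ) (u₁<u₂ : u₁ < u₂) (u₂<u₃ : u₂ < u₃)
         (zeroes : ∀ i → i < 5 → Δ i u₁ u₂ u₃ ≡ 0ℤ) where

  private
    e₁ = m≡m%n+[m/n]*n u₁ 16
    e₂ = m≡m%n+[m/n]*n u₂ 16
    e₃ = m≡m%n+[m/n]*n u₃ 16

  candidate : u₃ % 16 ∈ ((u₂ % 16 + u₂ % 16 + 0 + (16 ∸ u₁ % 16)) % 16 ∷ [])
  candidate = here (next-candidate 16 0 {u₁ / 16} {u₂ / 16} {u₃ / 16} {u₁ % 16} {u₂ % 16} {u₃ % 16} (m%n<n u₁ 16) (m%n<n u₃ 16)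
    (trans (cong₂ _+_ (sym e₁) (sym e₃)) (trans (balanced u₁ u₂ u₃ zeroes)
      (cong₂ _+_ e₂ (trans e₂ (sym (+-identityʳ (u₂ % 16 + u₂ / 16 * 16))))))))

  order : ∀ {u v} → u < v → u / 16 ≡ v / 16 → (u % 16 <ᵇ v % 16) ≡ true
  order {u} {v} u<v eq = <ᵇ-complete (offset-< 16 (v / 16)
    (subst₂ _<_ (trans (m≡m%n+[m/n]*n u 16) (cong (λ q → u % 16 + q * 16) eq)) (m≡m%n+[m/n]*n v 16) u<v))

  shifted : ∀ c → c < 5 → Δ c (u₁ % 16 + u₁ / 16 * 16) (u₂ % 16 + u₂ / 16 * 16) (u₃ % 16 + u₃ / 16 * 16) ≡ 0ℤ
  shifted c c<5 = Δ-cong c e₁ e₂ e₃ (zeroes c c<5)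

  squares-outcome : Outcome [] (u₁ / 16) (u₂ / 16) (u₃ / 16)
  squares-outcome = Squares.outcome [] (weigh (λ _ → 0ℤ)) squares-check
      (u₁ / 16) (u₂ / 16) (u₃ / 16) (u₁ % 16) (u₂ % 16) (u₃ % 16)
      (/-monoˡ-≤ 16 (<⇒≤ u₁<u₂)) (/-monoˡ-≤ 16 (<⇒≤ u₂<u₃)) (m%n<n u₁ 16) (m%n<n u₂ 16) (m%n<n u₃ 16)
      candidate (order u₁<u₂) (order u₂<u₃) refl refl
      (outer-equation (u₁ / 16) (u₂ / 16) (u₃ / 16) (u₁ % 16) (u₂ % 16) (u₃ % 16)
        (m%n<n u₁ 16) (m%n<n u₂ 16) (m%n<n u₃ 16) (λ _ → 0ℤ)
        shifted)

no-abelian-square : ∀ u₃ u₁ u₂ → ¬ AbelianSquare u₁ u₂ u₃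
no-abelian-square = <-rec _ go
  where
  finish : ∀ u₃ → 2 ≤ u₃ → (∀ {m} → m < u₃ → ∀ u₁ u₂ → ¬ AbelianSquare u₁ u₂ m) →
    ∀ q₁ q₂ → ¬ Outcome [] q₁ q₂ (u₃ / 16)
  finish u₃ 2≤ ih q₁ q₂ (inj₁ (v₁ , v₂ , v₃ , square , v₃≤)) = ih (≤-<-trans v₃≤ (suc[n/16]<n u₃ 2≤)) v₁ v₂ square
  go : ∀ u₃ → (∀ {m} → m < u₃ → ∀ u₁ u₂ → ¬ AbelianSquare u₁ u₂ m) → ∀ u₁ u₂ → ¬ AbelianSquare u₁ u₂ u₃
  go u₃ ih u₁ u₂ (u₁<u₂ , u₂<u₃ , zeroes) =
    finish u₃ (≤-trans (s≤s (≤-trans (s≤s z≤n) u₁<u₂)) u₂<u₃) ih (u₁ / 16) (u₂ / 16)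
      (squares-outcome u₁ u₂ u₃ u₁<u₂ u₂<u₃ zeroes)

-- Refutation of templates

-- The label of an offset is the letter of `a` found there, which has to match the template. All
-- third offsets are tried, with the letters as filter; the order is weak since cut points of an
-- instance may coincide.
module Parents (τ : Template) = Level 16 0 176 outer-block _≤ᵇ_ (λ b r → (b + f₀ r) % 5) (λ _ _ → 0)
  (λ c₁ c₂ _ → (c₁ ≡ᵇ Template.t₁ τ) ∧ (c₂ ≡ᵇ Template.t₂ τ)) (λ _ c₃ → c₃ ≡ᵇ Template.t₃ τ) (λ _ _ → upTo 16)

nonzero : Template → Bool
nonzero τ = any (λ i → not (Template.D τ i == 0ℤ)) letters

-- The check says that each parent of an instance of `τ` gives an abelian square or an instance of a
-- template in `τs`; `nonzero` serves the end of the descent.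
refutable : List Template → Template → Bool
refutable τs τ = nonzero τ ∧ Parents.check τ τs (weigh (Template.D τ))


refutable-split : ∀ τs τ → refutable τs τ ≡ true →
  nonzero τ ≡ true × Parents.check τ τs (weigh (Template.D τ)) ≡ true
refutable-split τs τ = ∧-split {nonzero τ} {Parents.check τ τs (weigh (Template.D τ))}

parent-outcome : ∀ τ τs → Parents.check τ τs (weigh (Template.D τ)) ≡ true → ∀ q₁ q₂ q₃ →
  Instance τ q₁ q₂ q₃ → Outcome τs (q₁ / 16) (q₂ / 16) (q₃ / 16)
parent-outcome τ τs ok q₁ q₂ q₃ (inst q₁≤q₂ q₂≤q₃ l₁ l₂ l₃ balance) =
  Parents.outcome τ τs (weigh (Template.D τ)) ok
    (q₁ / 16) (q₂ / 16) (q₃ / 16) (q₁ % 16) (q₂ % 16) (q₃ % 16)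
    (/-monoˡ-≤ 16 q₁≤q₂) (/-monoˡ-≤ 16 q₂≤q₃) (m%n<n q₁ 16) (m%n<n q₂ 16) (m%n<n q₃ 16)
    (∈-upTo⁺ {16} (m%n<n q₃ 16)) (ordered q₁≤q₂) (ordered q₂≤q₃)
    (both (≡ᵇ-complete (trans (sym (a-unfold q₁)) l₁)) (≡ᵇ-complete (trans (sym (a-unfold q₂)) l₂)))
    (≡ᵇ-complete (trans (sym (a-unfold q₃)) l₃))
    (outer-equation (q₁ / 16) (q₂ / 16) (q₃ / 16) (q₁ % 16) (q₂ % 16) (q₃ % 16)
      (m%n<n q₁ 16) (m%n<n q₂ 16) (m%n<n q₃ 16) (Template.D τ)
      (λ c c<5 → Δ-cong c (m≡m%n+[m/n]*n q₁ 16) (m≡m%n+[m/n]*n q₂ 16) (m≡m%n+[m/n]*n q₃ 16) (balance c c<5)))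
  where
  both : ∀ {x y} → x ≡ true → y ≡ true → x ∧ y ≡ true
  both refl refl = refl
  ordered : ∀ {u v} → u ≤ v → u / 16 ≡ v / 16 → (u % 16 ≤ᵇ v % 16) ≡ true
  ordered {u} {v} u≤v eq = ≤ᵇ-complete (+-cancelʳ-≤ (v / 16 * 16) (u % 16) (v % 16)
    (subst₂ _≤_ (trans (m≡m%n+[m/n]*n u 16) (cong (λ q → u % 16 + q * 16) eq)) (m≡m%n+[m/n]*n v 16) u≤v))

no-instance-at-0 : ∀ τ → nonzero τ ≡ true → ∀ q₁ q₂ → ¬ Instance τ q₁ q₂ 0
no-instance-at-0 τ nz q₁ q₂ (inst q₁≤q₂ z≤n _ _ _ balance) with q₁≤q₂
... | z≤n with i , i∈ , h ← any-sound (λ i → not (Template.D τ i == 0ℤ)) letters nz =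
    contradiction (trans (sym h) (cong (λ z → not (z == 0ℤ)) (sym (balance i (∈-upTo⁻ i∈))))) (λ ())

-- A list closed under parents allows endless descent, since squares are already excluded. Dividing
-- by 16 finally brings `q₃` to 0; then all cut points are 0 and `Δ` vanishes, against `nonzero`.
no-instance : ∀ τs → all (refutable τs) τs ≡ true →
  ∀ q₃ τ → τ ∈ τs → ∀ q₁ q₂ → ¬ Instance τ q₁ q₂ q₃
no-instance τs ok = <-rec _ go
  where
  Refuted : ℕ → Set
  Refuted q₃ = ∀ τ → τ ∈ τs → ∀ q₁ q₂ → ¬ Instance τ q₁ q₂ q₃
  finish : ∀ q₃ → (∀ {m} → m < suc q₃ → Refuted m) → ∀ q₁ q₂ → ¬ Outcome τs q₁ q₂ (suc q₃ / 16)
  finish q₃ ih q₁ q₂ (inj₁ (u₁ , u₂ , u₃ , square , _)) = no-abelian-square u₃ u₁ u₂ square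
  finish q₃ ih q₁ q₂ (inj₂ (τ , τ∈ , instance′)) =
    ih (m/n<m (suc q₃) 16 (s≤s (s≤s z≤n))) τ τ∈ q₁ q₂ instance′
  go : ∀ q₃ → (∀ {m} → m < q₃ → Refuted m) → Refuted q₃
  go zero ih τ τ∈ q₁ q₂ instance′ =
    no-instance-at-0 τ (proj₁ (refutable-split τs τ (all-sound (refutable τs) τs ok {τ} τ∈))) q₁ q₂ instance′
  go (suc q₃) ih τ τ∈ q₁ q₂ instance′ = finish q₃ ih (q₁ / 16) (q₂ / 16)
    (parent-outcome τ τs (proj₂ (refutable-split τs τ (all-sound (refutable τs) τs ok {τ} τ∈))) q₁ q₂ (suc q₃) instance′)

-- Occurrences of short factors

pattern o = Fin.zero
pattern ι = Fin.suc Fin.zero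

indicator : Word → Word → ℕ
indicator w u = if does (prefix? Fin._≟_ w u) then 1 else 0

count-∷ : ∀ w x u → ∣ x ∷ u ∣[ w ] ≡ indicator w (x ∷ u) + ∣ u ∣[ w ]
count-∷ w x u with does (prefix? Fin._≟_ w (x ∷ u))
... | true  = refl
... | false = refl

length-count : ∀ u → length u ≡ ∣ u ∣[ o ∷ [] ] + ∣ u ∣[ ι ∷ [] ]
length-count []      = refl
length-count (o ∷ u) = cong suc (length-count u)
length-count (ι ∷ u) = trans (cong suc (length-count u)) (sym (+-suc ∣ u ∣[ o ∷ [] ] ∣ u ∣[ ι ∷ [] ]))

indicator-left : ∀ a b x u →
  indicator (o ∷ a ∷ b ∷ []) (x ∷ u) + indicator (ι ∷ a ∷ b ∷ []) (x ∷ u) ≡ indicator (a ∷ b ∷ []) u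
indicator-left a b o u = +-identityʳ _
indicator-left a b ι u = refl

-- Every occurrence of `ab` is preceded by a letter, except one at the very beginning. Counts of
-- factors of lengths 2 and 3 therefore determine the first two letters.
count-prefix : ∀ a b u → ∣ u ∣[ a ∷ b ∷ [] ] ≡
  ∣ u ∣[ o ∷ a ∷ b ∷ [] ] + ∣ u ∣[ ι ∷ a ∷ b ∷ [] ] + indicator (a ∷ b ∷ []) u
count-prefix a b []      = refl
count-prefix a b (x ∷ u) = begin
  ∣ x ∷ u ∣[ a ∷ b ∷ [] ]                                       ≡⟨ count-∷ (a ∷ b ∷ []) x u ⟩
  I + ∣ u ∣[ a ∷ b ∷ [] ]                                       ≡⟨ cong (λ t → I + t) (count-prefix a b u) ⟩
  I + (C₀ + C₁ + indicator (a ∷ b ∷ []) u)                      ≡⟨ cong (λ t → I + (C₀ + C₁ + t)) (sym (indicator-left a b x u)) ⟩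
  I + (C₀ + C₁ + (I₀ + I₁))                                     ≡⟨ ring I C₀ C₁ I₀ I₁ ⟩
  (I₀ + C₀) + (I₁ + C₁) + I                                     ≡⟨ cong₂ (λ s t → s + t + I)
                                                                     (sym (count-∷ (o ∷ a ∷ b ∷ []) x u))
                                                                     (sym (count-∷ (ι ∷ a ∷ b ∷ []) x u)) ⟩
  ∣ x ∷ u ∣[ o ∷ a ∷ b ∷ [] ] + ∣ x ∷ u ∣[ ι ∷ a ∷ b ∷ [] ] + I  ∎
  where
  open ≡-Reasoning
  I  = indicator (a ∷ b ∷ []) (x ∷ u)
  I₀ = indicator (o ∷ a ∷ b ∷ []) (x ∷ u)
  I₁ = indicator (ι ∷ a ∷ b ∷ []) (x ∷ u)
  C₀ = ∣ u ∣[ o ∷ a ∷ b ∷ [] ]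
  C₁ = ∣ u ∣[ ι ∷ a ∷ b ∷ [] ]
  ring : ∀ i c d j k → i + (c + d + (j + k)) ≡ (j + c) + (k + d) + i
  ring = ℕ.solve-∀

end-here : Fin 2 → Fin 2 → Word → ℕ
end-here a b u@(_ ∷ _ ∷ []) = indicator (a ∷ b ∷ []) u
end-here a b _              = 0

-- `end-here` can be nonzero only at the tail of length 2, so this sum has at most one nonzero term
-- and tells whether the word ends in `ab`.
suffix-indicator : Fin 2 → Fin 2 → Word → ℕ
suffix-indicator a b []      = 0
suffix-indicator a b (x ∷ u) = end-here a b (x ∷ u) + suffix-indicator a b u

indicator-right : ∀ a b u → indicator (a ∷ b ∷ []) u ≡
  indicator (a ∷ b ∷ o ∷ []) u + indicator (a ∷ b ∷ ι ∷ []) u + end-here a b u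
indicator-right a b []               = refl
indicator-right o b (o ∷ [])         = refl
indicator-right ι b (o ∷ [])         = refl
indicator-right o b (ι ∷ [])         = refl
indicator-right ι b (ι ∷ [])         = refl
indicator-right a b (x ∷ y ∷ [])     with does (a Fin.≟ x) | does (b Fin.≟ y)
... | true  | true  = refl
... | true  | false = refl
... | false | _     = refl
indicator-right a b (x ∷ y ∷ o ∷ u)  with does (a Fin.≟ x) | does (b Fin.≟ y)
... | true  | true  = refl
... | true  | false = refl
... | false | _     = refl
indicator-right a b (x ∷ y ∷ ι ∷ u)  with does (a Fin.≟ x) | does (b Fin.≟ y)
... | true  | true  = refl
... | true  | false = refl
... | false | _     = refl

count-suffix : ∀ a b u → ∣ u ∣[ a ∷ b ∷ [] ] ≡
  ∣ u ∣[ a ∷ b ∷ o ∷ [] ] + ∣ u ∣[ a ∷ b ∷ ι ∷ [] ] + suffix-indicator a b u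
count-suffix a b []      = refl
count-suffix a b (x ∷ u) = begin
  ∣ x ∷ u ∣[ a ∷ b ∷ [] ]                   ≡⟨ count-∷ (a ∷ b ∷ []) x u ⟩
  indicator (a ∷ b ∷ []) (x ∷ u) + ∣ u ∣[ a ∷ b ∷ [] ]
    ≡⟨ cong₂ _+_ (indicator-right a b (x ∷ u)) (count-suffix a b u) ⟩
  (I₀ + I₁ + E) + (C₀ + C₁ + S)             ≡⟨ ring I₀ I₁ E C₀ C₁ S ⟩
  (I₀ + C₀) + (I₁ + C₁) + (E + S)           ≡⟨ cong₂ (λ s t → s + t + (E + S))
                                                 (sym (count-∷ (a ∷ b ∷ o ∷ []) x u))
                                                 (sym (count-∷ (a ∷ b ∷ ι ∷ []) x u)) ⟩
  ∣ x ∷ u ∣[ a ∷ b ∷ o ∷ [] ] + ∣ x ∷ u ∣[ a ∷ b ∷ ι ∷ [] ] + (E + S) ∎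
  where
  open ≡-Reasoning
  I₀ = indicator (a ∷ b ∷ o ∷ []) (x ∷ u)
  I₁ = indicator (a ∷ b ∷ ι ∷ []) (x ∷ u)
  C₀ = ∣ u ∣[ a ∷ b ∷ o ∷ [] ]
  C₁ = ∣ u ∣[ a ∷ b ∷ ι ∷ [] ]
  E = end-here a b (x ∷ u)
  S = suffix-indicator a b u
  ring : ∀ i j e c d s → (i + j + e) + (c + d + s) ≡ (i + c) + (j + d) + (e + s)
  ring = ℕ.solve-∀

-- Weighted counts of factors of length 3

Weighting : Set
Weighting = Fin 2 → Fin 2 → Fin 2 → ℤ

head-weight : Weighting → Word → ℤ
head-weight f (x ∷ y ∷ z ∷ _) = f x y z
head-weight f _               = 0ℤ

total-weight : Weighting → Word → ℤ
total-weight f []      = 0ℤ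
total-weight f (x ∷ u) = head-weight f (x ∷ u) ℤ.+ total-weight f u

weighted-count : Weighting → (Word → ℕ) → ℤ
weighted-count f N = ∑₃ (λ x y z → f x y z ℤ.* + N (x ∷ y ∷ z ∷ []))
  where
  ∑₁ : (Fin 2 → ℤ) → ℤ
  ∑₁ g = g o ℤ.+ g ι
  ∑₃ : (Fin 2 → Fin 2 → Fin 2 → ℤ) → ℤ
  ∑₃ g = ∑₁ (λ x → ∑₁ (λ y → ∑₁ (g x y)))

weighted-count-+ : ∀ f M N → weighted-count f (λ w → M w + N w) ≡ weighted-count f M ℤ.+ weighted-count f N
weighted-count-+ f M N = trans
  (cong₂ ℤ._+_ (half (f o) (M ∘ (o ∷_)) (N ∘ (o ∷_))) (half (f ι) (M ∘ (ι ∷_)) (N ∘ (ι ∷_))))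
  (swap (half-sum (f o) (M ∘ (o ∷_))) (half-sum (f o) (N ∘ (o ∷_))) (half-sum (f ι) (M ∘ (ι ∷_))) (half-sum (f ι) (N ∘ (ι ∷_))))
  where
  half-sum : (Fin 2 → Fin 2 → ℤ) → (Word → ℕ) → ℤ
  half-sum f M = (f o o ℤ.* + M (o ∷ o ∷ []) ℤ.+ f o ι ℤ.* + M (o ∷ ι ∷ []))
    ℤ.+ (f ι o ℤ.* + M (ι ∷ o ∷ []) ℤ.+ f ι ι ℤ.* + M (ι ∷ ι ∷ []))
  swap : ∀ a b c d → (a ℤ.+ b) ℤ.+ (c ℤ.+ d) ≡ (a ℤ.+ c) ℤ.+ (b ℤ.+ d)
  swap = solve-∀
  pair : ∀ p q m n m′ n′ → p ℤ.* + (m + n) ℤ.+ q ℤ.* + (m′ + n′)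
    ≡ (p ℤ.* + m ℤ.+ q ℤ.* + m′) ℤ.+ (p ℤ.* + n ℤ.+ q ℤ.* + n′)
  pair p q m n m′ n′ = trans (cong₂ ℤ._+_ (ℤ.*-distribˡ-+ p (+ m) (+ n)) (ℤ.*-distribˡ-+ q (+ m′) (+ n′)))
    (swap (p ℤ.* + m) (p ℤ.* + n) (q ℤ.* + m′) (q ℤ.* + n′))
  half : ∀ f M N → half-sum f (λ w → M w + N w) ≡ half-sum f M ℤ.+ half-sum f N
  half f M N = trans (cong₂ ℤ._+_
      (pair (f o o) (f o ι) (M (o ∷ o ∷ [])) (N (o ∷ o ∷ [])) (M (o ∷ ι ∷ [])) (N (o ∷ ι ∷ [])))
      (pair (f ι o) (f ι ι) (M (ι ∷ o ∷ [])) (N (ι ∷ o ∷ [])) (M (ι ∷ ι ∷ [])) (N (ι ∷ ι ∷ []))))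
    (swap (f o o ℤ.* + M (o ∷ o ∷ []) ℤ.+ f o ι ℤ.* + M (o ∷ ι ∷ []))
          (f o o ℤ.* + N (o ∷ o ∷ []) ℤ.+ f o ι ℤ.* + N (o ∷ ι ∷ []))
          (f ι o ℤ.* + M (ι ∷ o ∷ []) ℤ.+ f ι ι ℤ.* + M (ι ∷ ι ∷ []))
          (f ι o ℤ.* + N (ι ∷ o ∷ []) ℤ.+ f ι ι ℤ.* + N (ι ∷ ι ∷ [])))

head-weight-count : ∀ f u → head-weight f u ≡ weighted-count f (λ w → indicator w u)
head-weight-count f = λ where
    []                → l-none
    (o ∷ [])          → l-none
    (ι ∷ [])          → l-none
    (o ∷ o ∷ [])      → l-none
    (o ∷ ι ∷ [])      → l-none
    (ι ∷ o ∷ [])      → l-none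
    (ι ∷ ι ∷ [])      → l-none
    (o ∷ o ∷ o ∷ _)   → l₀ (f o o o) (f o o ι) (f o ι o) (f o ι ι) (f ι o o) (f ι o ι) (f ι ι o) (f ι ι ι)
    (o ∷ o ∷ ι ∷ _)   → l₁ (f o o o) (f o o ι) (f o ι o) (f o ι ι) (f ι o o) (f ι o ι) (f ι ι o) (f ι ι ι)
    (o ∷ ι ∷ o ∷ _)   → l₂ (f o o o) (f o o ι) (f o ι o) (f o ι ι) (f ι o o) (f ι o ι) (f ι ι o) (f ι ι ι)
    (o ∷ ι ∷ ι ∷ _)   → l₃ (f o o o) (f o o ι) (f o ι o) (f o ι ι) (f ι o o) (f ι o ι) (f ι ι o) (f ι ι ι)
    (ι ∷ o ∷ o ∷ _)   → l₄ (f o o o) (f o o ι) (f o ι o) (f o ι ι) (f ι o o) (f ι o ι) (f ι ι o) (f ι ι ι)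
    (ι ∷ o ∷ ι ∷ _)   → l₅ (f o o o) (f o o ι) (f o ι o) (f o ι ι) (f ι o o) (f ι o ι) (f ι ι o) (f ι ι ι)
    (ι ∷ ι ∷ o ∷ _)   → l₆ (f o o o) (f o o ι) (f o ι o) (f o ι ι) (f ι o o) (f ι o ι) (f ι ι o) (f ι ι ι)
    (ι ∷ ι ∷ ι ∷ _)   → l₇ (f o o o) (f o o ι) (f o ι o) (f o ι ι) (f ι o o) (f ι o ι) (f ι ι o) (f ι ι ι)
  where
  zeros : ∀ a b c d e g h i → ((a ℤ.* 0ℤ ℤ.+ b ℤ.* 0ℤ) ℤ.+ (c ℤ.* 0ℤ ℤ.+ d ℤ.* 0ℤ))
    ℤ.+ ((e ℤ.* 0ℤ ℤ.+ g ℤ.* 0ℤ) ℤ.+ (h ℤ.* 0ℤ ℤ.+ i ℤ.* 0ℤ)) ≡ 0ℤ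
  zeros = solve-∀
  l-none = sym (zeros (f o o o) (f o o ι) (f o ι o) (f o ι ι) (f ι o o) (f ι o ι) (f ι ι o) (f ι ι ι))
  l₀ : ∀ a b c d e g h i → a ≡ ((a ℤ.* 1ℤ ℤ.+ b ℤ.* 0ℤ) ℤ.+ (c ℤ.* 0ℤ ℤ.+ d ℤ.* 0ℤ))
    ℤ.+ ((e ℤ.* 0ℤ ℤ.+ g ℤ.* 0ℤ) ℤ.+ (h ℤ.* 0ℤ ℤ.+ i ℤ.* 0ℤ))
  l₀ = solve-∀
  l₁ : ∀ a b c d e g h i → b ≡ ((a ℤ.* 0ℤ ℤ.+ b ℤ.* 1ℤ) ℤ.+ (c ℤ.* 0ℤ ℤ.+ d ℤ.* 0ℤ))
    ℤ.+ ((e ℤ.* 0ℤ ℤ.+ g ℤ.* 0ℤ) ℤ.+ (h ℤ.* 0ℤ ℤ.+ i ℤ.* 0ℤ))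
  l₁ = solve-∀
  l₂ : ∀ a b c d e g h i → c ≡ ((a ℤ.* 0ℤ ℤ.+ b ℤ.* 0ℤ) ℤ.+ (c ℤ.* 1ℤ ℤ.+ d ℤ.* 0ℤ))
    ℤ.+ ((e ℤ.* 0ℤ ℤ.+ g ℤ.* 0ℤ) ℤ.+ (h ℤ.* 0ℤ ℤ.+ i ℤ.* 0ℤ))
  l₂ = solve-∀
  l₃ : ∀ a b c d e g h i → d ≡ ((a ℤ.* 0ℤ ℤ.+ b ℤ.* 0ℤ) ℤ.+ (c ℤ.* 0ℤ ℤ.+ d ℤ.* 1ℤ))
    ℤ.+ ((e ℤ.* 0ℤ ℤ.+ g ℤ.* 0ℤ) ℤ.+ (h ℤ.* 0ℤ ℤ.+ i ℤ.* 0ℤ))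
  l₃ = solve-∀
  l₄ : ∀ a b c d e g h i → e ≡ ((a ℤ.* 0ℤ ℤ.+ b ℤ.* 0ℤ) ℤ.+ (c ℤ.* 0ℤ ℤ.+ d ℤ.* 0ℤ))
    ℤ.+ ((e ℤ.* 1ℤ ℤ.+ g ℤ.* 0ℤ) ℤ.+ (h ℤ.* 0ℤ ℤ.+ i ℤ.* 0ℤ))
  l₄ = solve-∀
  l₅ : ∀ a b c d e g h i → g ≡ ((a ℤ.* 0ℤ ℤ.+ b ℤ.* 0ℤ) ℤ.+ (c ℤ.* 0ℤ ℤ.+ d ℤ.* 0ℤ))
    ℤ.+ ((e ℤ.* 0ℤ ℤ.+ g ℤ.* 1ℤ) ℤ.+ (h ℤ.* 0ℤ ℤ.+ i ℤ.* 0ℤ))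
  l₅ = solve-∀
  l₆ : ∀ a b c d e g h i → h ≡ ((a ℤ.* 0ℤ ℤ.+ b ℤ.* 0ℤ) ℤ.+ (c ℤ.* 0ℤ ℤ.+ d ℤ.* 0ℤ))
    ℤ.+ ((e ℤ.* 0ℤ ℤ.+ g ℤ.* 0ℤ) ℤ.+ (h ℤ.* 1ℤ ℤ.+ i ℤ.* 0ℤ))
  l₆ = solve-∀
  l₇ : ∀ a b c d e g h i → i ≡ ((a ℤ.* 0ℤ ℤ.+ b ℤ.* 0ℤ) ℤ.+ (c ℤ.* 0ℤ ℤ.+ d ℤ.* 0ℤ))
    ℤ.+ ((e ℤ.* 0ℤ ℤ.+ g ℤ.* 0ℤ) ℤ.+ (h ℤ.* 0ℤ ℤ.+ i ℤ.* 1ℤ))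
  l₇ = solve-∀

weighted-count-cong : ∀ f M N → (∀ x y z → M (x ∷ y ∷ z ∷ []) ≡ N (x ∷ y ∷ z ∷ [])) →
  weighted-count f M ≡ weighted-count f N
weighted-count-cong f M N h = plus (plus (plus (at o o o) (at o o ι)) (plus (at o ι o) (at o ι ι)))
  (plus (plus (at ι o o) (at ι o ι)) (plus (at ι ι o) (at ι ι ι)))
  where
  plus : ∀ {a b c d} → a ≡ b → c ≡ d → a ℤ.+ c ≡ b ℤ.+ d
  plus = cong₂ ℤ._+_
  at : ∀ x y z → f x y z ℤ.* + M (x ∷ y ∷ z ∷ []) ≡ f x y z ℤ.* + N (x ∷ y ∷ z ∷ [])
  at x y z = cong (λ n → f x y z ℤ.* + n) (h x y z)

total-weight-count : ∀ f u → total-weight f u ≡ weighted-count f (λ w → ∣ u ∣[ w ])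
total-weight-count f []      = head-weight-count f []
total-weight-count f (x ∷ u) = begin
  head-weight f (x ∷ u) ℤ.+ total-weight f u
    ≡⟨ cong₂ ℤ._+_ (head-weight-count f (x ∷ u)) (total-weight-count f u) ⟩
  weighted-count f (λ w → indicator w (x ∷ u)) ℤ.+ weighted-count f (λ w → ∣ u ∣[ w ])
    ≡⟨ sym (weighted-count-+ f (λ w → indicator w (x ∷ u)) (λ w → ∣ u ∣[ w ])) ⟩
  weighted-count f (λ w → indicator w (x ∷ u) + ∣ u ∣[ w ])
    ≡⟨ weighted-count-cong f (λ w → indicator w (x ∷ u) + ∣ u ∣[ w ]) (λ w → ∣ x ∷ u ∣[ w ])
         (λ x′ y z → sym (count-∷ (x′ ∷ y ∷ z ∷ []) x u)) ⟩
  weighted-count f (λ w → ∣ x ∷ u ∣[ w ]) ∎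
  where open ≡-Reasoning

indicator-refl : ∀ a b u → indicator (a ∷ b ∷ []) (a ∷ b ∷ u) ≡ 1
indicator-refl o o u = refl
indicator-refl o ι u = refl
indicator-refl ι o u = refl
indicator-refl ι ι u = refl

indicator-letters : ∀ a b c d u → indicator (a ∷ b ∷ []) (c ∷ d ∷ u) ≡ 1 → a ≡ c × b ≡ d
indicator-letters o o o o u e = refl , refl
indicator-letters o ι o ι u e = refl , refl
indicator-letters ι o ι o u e = refl , refl
indicator-letters ι ι ι ι u e = refl , refl
indicator-letters o o o ι u ()
indicator-letters o o ι d u ()
indicator-letters o ι o o u ()
indicator-letters o ι ι d u ()
indicator-letters ι o o d u ()
indicator-letters ι o ι ι u ()
indicator-letters ι ι o d u ()
indicator-letters ι ι ι o u ()

-- Consequences of 3-abelian equivalence for segments of an infinite word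

module _ (y : InfWord) where

  factor-weight : Weighting → ℕ → ℤ
  factor-weight f p = f (y p) (y (1 + p)) (y (2 + p))

  segment-2 : ∀ i n → segment y i (2 + n) ≡ y i ∷ y (1 + i) ∷ segment y (2 + i) n
  segment-2 i n = trans (segment-suc y i (1 + n)) (cong (y i ∷_) (segment-suc y (1 + i) n))

  segment-3 : ∀ i n → segment y i (3 + n) ≡ y i ∷ y (1 + i) ∷ y (2 + i) ∷ segment y (3 + i) n
  segment-3 i n = trans (segment-suc y i (2 + n)) (cong (y i ∷_) (segment-2 (1 + i) n))

  -- A word of length `2 + n` has `n` factors of length 3, and those of the segment start at `i` up
  -- to `n + i − 1`.
  segment-weight : ∀ f n i →
    total-weight f (segment y i (2 + n)) ℤ.+ ∑ i (factor-weight f) ≡ ∑ (n + i) (factor-weight f)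
  segment-weight f zero    i = ℤ.+-identityˡ (∑ i (factor-weight f))
  segment-weight f (suc n) i = begin
      total-weight f (segment y i (3 + n)) ℤ.+ ∑ i w      ≡⟨ cong (λ u → total-weight f u ℤ.+ ∑ i w) (segment-3 i n) ⟩
      (w i ℤ.+ rest) ℤ.+ ∑ i w                            ≡⟨ swap (w i) rest (∑ i w) ⟩
      rest ℤ.+ ∑ (suc i) w
        ≡⟨ cong (λ u → total-weight f u ℤ.+ ∑ (suc i) w) (sym (segment-2 (1 + i) n)) ⟩
      total-weight f (segment y (1 + i) (2 + n)) ℤ.+ ∑ (suc i) w ≡⟨ segment-weight f n (suc i) ⟩
      ∑ (n + suc i) w                                     ≡⟨ cong (λ k → ∑ k w) (+-suc n i) ⟩
      ∑ (suc n + i) w                                     ∎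
    where
    open ≡-Reasoning
    w = factor-weight f
    rest = total-weight f (y (1 + i) ∷ y (2 + i) ∷ segment y (3 + i) n)
    swap : ∀ a b c → (a ℤ.+ b) ℤ.+ c ≡ b ℤ.+ (c ℤ.+ a)
    swap = solve-∀

  segment-suffix : ∀ a b n i → suffix-indicator a b (segment y i (2 + n))
    ≡ indicator (a ∷ b ∷ []) (y (n + i) ∷ y (1 + n + i) ∷ [])
  segment-suffix a b zero    i = trans (cong (suffix-indicator a b) (segment-2 i 0)) (+-identityʳ _)
  segment-suffix a b (suc n) i = trans (cong (suffix-indicator a b) (segment-3 i n))
    (trans (cong (suffix-indicator a b) (sym (segment-2 (1 + i) n)))
      (trans (segment-suffix a b n (suc i))
        (cong (λ k → indicator (a ∷ b ∷ []) (y k ∷ y (1 + k) ∷ [])) (+-suc n i))))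

  segment-prefix : ∀ a b n i → indicator (a ∷ b ∷ []) (segment y i (2 + n)) ≡
    indicator (a ∷ b ∷ []) (y i ∷ y (1 + i) ∷ segment y (2 + i) n)
  segment-prefix a b n i = cong (indicator (a ∷ b ∷ [])) (segment-2 i n)

  module _ (i j n : ℕ) (equivalent : KAbelianEquivalent 3 (segment y i (2 + n)) (segment y j (2 + n))) where

    count₂ : ∀ a b → ∣ segment y i (2 + n) ∣[ a ∷ b ∷ [] ] ≡ ∣ segment y j (2 + n) ∣[ a ∷ b ∷ [] ]
    count₂ a b = equivalent (a ∷ b ∷ []) (λ ()) (s≤s (s≤s z≤n))

    count₃ : ∀ a b c → ∣ segment y i (2 + n) ∣[ a ∷ b ∷ c ∷ [] ] ≡ ∣ segment y j (2 + n) ∣[ a ∷ b ∷ c ∷ [] ]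
    count₃ a b c = equivalent (a ∷ b ∷ c ∷ []) (λ ()) (s≤s (s≤s (s≤s z≤n)))

    same-prefix : y i ≡ y j × y (1 + i) ≡ y (1 + j)
    same-prefix = indicator-letters (y i) (y (1 + i)) (y j) (y (1 + j)) (segment y (2 + j) n)
      (trans (sym (segment-prefix α β n j)) (trans (sym same) (trans (segment-prefix α β n i) (indicator-refl α β (segment y (2 + i) n)))))
      where
      α = y i
      β = y (1 + i)
      same : indicator (α ∷ β ∷ []) (segment y i (2 + n)) ≡ indicator (α ∷ β ∷ []) (segment y j (2 + n))
      same = +-cancelˡ-≡ (∣ segment y i (2 + n) ∣[ o ∷ α ∷ β ∷ [] ] + ∣ segment y i (2 + n) ∣[ ι ∷ α ∷ β ∷ [] ]) _ _
        (trans (sym (count-prefix α β (segment y i (2 + n)))) (trans (count₂ α β)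
          (trans (count-prefix α β (segment y j (2 + n)))
            (cong₂ (λ s t → s + t + indicator (α ∷ β ∷ []) (segment y j (2 + n))) (sym (count₃ o α β)) (sym (count₃ ι α β))))))

    same-suffix : y (n + i) ≡ y (n + j) × y (1 + n + i) ≡ y (1 + n + j)
    same-suffix = indicator-letters α β (y (n + j)) (y (1 + n + j)) []
      (trans (sym (segment-suffix α β n j)) (trans (sym same) (trans (segment-suffix α β n i) (indicator-refl α β []))))
      where
      α = y (n + i)
      β = y (1 + n + i)
      same : suffix-indicator α β (segment y i (2 + n)) ≡ suffix-indicator α β (segment y j (2 + n))
      same = +-cancelˡ-≡ (∣ segment y i (2 + n) ∣[ α ∷ β ∷ o ∷ [] ] + ∣ segment y i (2 + n) ∣[ α ∷ β ∷ ι ∷ [] ]) _ _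
        (trans (sym (count-suffix α β (segment y i (2 + n)))) (trans (count₂ α β)
          (trans (count-suffix α β (segment y j (2 + n)))
            (cong₂ (λ s t → s + t + suffix-indicator α β (segment y j (2 + n))) (sym (count₃ α β o)) (sym (count₃ α β ι))))))

    -- Equal total weights, each a difference of two initial sums, rearranged without subtraction.
    -- For adjacent halves `j` is `2 + (n + i)`, so the right-hand side reads the middle cut point
    -- twice.
    same-weight : ∀ f → ∑ i (factor-weight f) ℤ.+ ∑ (n + j) (factor-weight f)
      ≡ ∑ (n + i) (factor-weight f) ℤ.+ ∑ j (factor-weight f)
    same-weight f = begin
      ∑ i w ℤ.+ ∑ (n + j) w              ≡⟨ cong (λ t → ∑ i w ℤ.+ t) (sym (segment-weight f n j)) ⟩
      ∑ i w ℤ.+ (Tⱼ ℤ.+ ∑ j w)           ≡⟨ ring (∑ i w) Tⱼ (∑ j w) ⟩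
      (Tⱼ ℤ.+ ∑ i w) ℤ.+ ∑ j w           ≡⟨ cong (λ t → (t ℤ.+ ∑ i w) ℤ.+ ∑ j w) (sym same) ⟩
      (Tᵢ ℤ.+ ∑ i w) ℤ.+ ∑ j w           ≡⟨ cong (λ t → t ℤ.+ ∑ j w) (segment-weight f n i) ⟩
      ∑ (n + i) w ℤ.+ ∑ j w              ∎
      where
      open ≡-Reasoning
      w = factor-weight f
      Tᵢ = total-weight f (segment y i (2 + n))
      Tⱼ = total-weight f (segment y j (2 + n))
      same : Tᵢ ≡ Tⱼ
      same = trans (total-weight-count f (segment y i (2 + n)))
        (trans (weighted-count-cong f (λ w → ∣ segment y i (2 + n) ∣[ w ]) (λ w → ∣ segment y j (2 + n) ∣[ w ]) count₃)
          (sym (total-weight-count f (segment y j (2 + n)))))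
      ring : ∀ a b c → a ℤ.+ (b ℤ.+ c) ≡ (b ℤ.+ a) ℤ.+ c
      ring = solve-∀

  same-length : ∀ {u v} → KAbelianEquivalent 3 u v → length u ≡ length v
  same-length {u} {v} e = trans (length-count u) (trans
    (cong₂ _+_ (e (o ∷ []) (λ ()) (s≤s z≤n)) (e (ι ∷ []) (λ ()) (s≤s z≤n))) (sym (length-count v)))

  segment-split : ∀ u v i n → u ++ v ≡ segment y i (length u + n) →
    u ≡ segment y i (length u) × v ≡ segment y (length u + i) n
  segment-split []      v i n e = refl , e
  segment-split (x ∷ u) v i n e
    with h , t ← segment-split u v (suc i) n (∷-injectiveʳ (trans e (segment-suc y i (length u + n)))) =
    trans (cong₂ _∷_ (∷-injectiveˡ (trans e (segment-suc y i (length u + n)))) h) (sym (segment-suc y i (length u))) ,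
    trans t (cong (λ k → segment y k n) (+-suc (length u) i))

-- The binary substitution and its weights

common : Word
common = ι ∷ o ∷ o ∷ o ∷ ι ∷ ι ∷ o ∷ ι ∷ o ∷ ι ∷ o ∷ ι ∷ []

images : List Word
images = 
  (ι ∷ o ∷ o ∷ o ∷ ι ∷ ι ∷ o ∷ ι ∷ o ∷ ι ∷ o ∷ ι ∷ ι ∷ ι ∷ o ∷ ι ∷ o ∷ ι ∷ o ∷ o ∷ o ∷ ι ∷ o ∷ ι ∷
    o ∷ ι ∷ o ∷ o ∷ ι ∷ ι ∷ o ∷ o ∷ o ∷ ι ∷ o ∷ ι ∷ o ∷ ι ∷ o ∷ o ∷ o ∷ ι ∷ ι ∷ ι ∷ o ∷ o ∷ o ∷ ι ∷
    o ∷ ι ∷ o ∷ o ∷ ι ∷ ι ∷ o ∷ o ∷ o ∷ ι ∷ ι ∷ ι ∷ o ∷ o ∷ ι ∷ o ∷ ι ∷ ι ∷ ι ∷ o ∷ o ∷ o ∷ ι ∷ o ∷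
    ι ∷ o ∷ o ∷ o ∷ ι ∷ ι ∷ o ∷ o ∷ ι ∷ o ∷ ι ∷ o ∷ []) ∷
  (ι ∷ o ∷ o ∷ o ∷ ι ∷ ι ∷ o ∷ ι ∷ o ∷ ι ∷ o ∷ ι ∷ ι ∷ ι ∷ o ∷ ι ∷ o ∷ ι ∷ o ∷ o ∷ o ∷ ι ∷ o ∷ ι ∷
    ι ∷ ι ∷ o ∷ o ∷ o ∷ ι ∷ ι ∷ o ∷ ι ∷ o ∷ o ∷ o ∷ ι ∷ ι ∷ ι ∷ o ∷ ι ∷ o ∷ ι ∷ o ∷ ι ∷ ι ∷ o ∷ o ∷
    o ∷ ι ∷ ι ∷ o ∷ ι ∷ o ∷ ι ∷ ι ∷ o ∷ o ∷ ι ∷ ι ∷ ι ∷ o ∷ ι ∷ o ∷ ι ∷ ι ∷ o ∷ o ∷ o ∷ ι ∷ ι ∷ o ∷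
    ι ∷ o ∷ ι ∷ o ∷ o ∷ ι ∷ ι ∷ o ∷ o ∷ o ∷ ι ∷ o ∷ []) ∷
  (ι ∷ o ∷ o ∷ o ∷ ι ∷ ι ∷ o ∷ ι ∷ o ∷ ι ∷ o ∷ ι ∷ ι ∷ o ∷ o ∷ ι ∷ o ∷ ι ∷ o ∷ ι ∷ o ∷ o ∷ ι ∷ ι ∷
    ι ∷ o ∷ o ∷ o ∷ ι ∷ o ∷ ι ∷ ι ∷ ι ∷ o ∷ ι ∷ o ∷ ι ∷ o ∷ o ∷ o ∷ ι ∷ o ∷ ι ∷ o ∷ ι ∷ o ∷ o ∷ ι ∷
    ι ∷ ι ∷ o ∷ o ∷ ι ∷ o ∷ ι ∷ o ∷ ι ∷ o ∷ o ∷ ι ∷ ι ∷ o ∷ ι ∷ o ∷ ι ∷ o ∷ ι ∷ ι ∷ ι ∷ o ∷ o ∷ ι ∷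
    ι ∷ o ∷ ι ∷ o ∷ ι ∷ ι ∷ o ∷ o ∷ ι ∷ o ∷ ι ∷ o ∷ []) ∷
  (ι ∷ o ∷ o ∷ o ∷ ι ∷ ι ∷ o ∷ ι ∷ o ∷ ι ∷ o ∷ ι ∷ ι ∷ o ∷ o ∷ ι ∷ ι ∷ ι ∷ o ∷ o ∷ o ∷ ι ∷ ι ∷ o ∷
    o ∷ ι ∷ o ∷ ι ∷ ι ∷ o ∷ o ∷ o ∷ ι ∷ o ∷ ι ∷ o ∷ o ∷ ι ∷ ι ∷ ι ∷ o ∷ o ∷ o ∷ ι ∷ ι ∷ o ∷ o ∷ ι ∷
    o ∷ ι ∷ o ∷ o ∷ ι ∷ ι ∷ ι ∷ o ∷ o ∷ ι ∷ o ∷ ι ∷ o ∷ ι ∷ ι ∷ ι ∷ o ∷ o ∷ o ∷ ι ∷ ι ∷ o ∷ o ∷ ι ∷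
    o ∷ ι ∷ ι ∷ ι ∷ o ∷ o ∷ ι ∷ ι ∷ o ∷ ι ∷ o ∷ ι ∷ []) ∷
  (ι ∷ o ∷ o ∷ o ∷ ι ∷ ι ∷ o ∷ ι ∷ o ∷ ι ∷ o ∷ ι ∷ ι ∷ ι ∷ o ∷ o ∷ o ∷ ι ∷ o ∷ ι ∷ ι ∷ o ∷ o ∷ ι ∷
    o ∷ ι ∷ o ∷ ι ∷ ι ∷ ι ∷ o ∷ o ∷ ι ∷ o ∷ ι ∷ o ∷ o ∷ ι ∷ ι ∷ o ∷ ι ∷ o ∷ ι ∷ ι ∷ o ∷ o ∷ ι ∷ ι ∷
    ι ∷ o ∷ ι ∷ o ∷ ι ∷ ι ∷ ι ∷ o ∷ o ∷ o ∷ ι ∷ ι ∷ ι ∷ o ∷ ι ∷ o ∷ ι ∷ o ∷ ι ∷ ι ∷ ι ∷ o ∷ o ∷ ι ∷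
    ι ∷ o ∷ ι ∷ o ∷ o ∷ o ∷ ι ∷ ι ∷ ι ∷ o ∷ ι ∷ o ∷ []) ∷ []

-- As all images start with `common`, appending it gives the correct letters up to 12 places beyond
-- a block, whichever block follows.
bit : ℕ → ℕ → Fin 2
bit b = nth o (nth [] images b ++ common)

y : InfWord
y p = nth o (nth [] images (a (p / 84))) (p % 84)

_≟ᵇ_ : Fin 2 → Fin 2 → Bool
x ≟ᵇ z = Fin.toℕ x ≡ᵇ Fin.toℕ z

≟ᵇ-sound : ∀ x z → (x ≟ᵇ z) ≡ true → x ≡ z
≟ᵇ-sound x z e = Fin.toℕ-injective (≡ᵇ-sound e)

bit-inside : ∀ b r → b < 5 → r < 84 → bit b r ≡ nth o (nth [] images b) r
bit-inside b r b<5 r<L = ≟ᵇ-sound (bit b r) (nth o (nth [] images b) r)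
  (all-upTo {84} (λ r → bit b r ≟ᵇ nth o (nth [] images b) r)
    (all-upTo {5} (λ b → all (λ r → bit b r ≟ᵇ nth o (nth [] images b) r) (upTo 84)) refl b<5) r<L)

bit-outside : ∀ b c s → b < 5 → c < 5 → s < 12 → bit b (84 + s) ≡ nth o (nth [] images c) s
bit-outside b c s b<5 c<5 s<P = ≟ᵇ-sound (bit b (84 + s)) (nth o (nth [] images c) s)
  (all-upTo {12} (λ s → bit b (84 + s) ≟ᵇ nth o (nth [] images c) s)
    (check-letters (λ b c → all (λ s → bit b (84 + s) ≟ᵇ nth o (nth [] images c) s) (upTo 12)) refl b c b<5 c<5) s<P)

y-at : ∀ q r → r < 84 → y (r + q * 84) ≡ nth o (nth [] images (a q)) r
y-at q r r<L = cong₂ (λ q r → nth o (nth [] images (a q)) r)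
  (proj₁ (divmod-unique 84 q r r<L)) (proj₂ (divmod-unique 84 q r r<L))

y-block : ∀ q r → r < 96 → y (r + q * 84) ≡ bit (a q) r
y-block q r r<96 with <-≤-connex r 84
... | inj₁ r<L = trans (y-at q r r<L) (sym (bit-inside (a q) r (a<5 q) r<L))
... | inj₂ L≤r = trans (cong y next) (trans (y-at (suc q) s (≤-trans s<P (m≤m+n 12 72)))
    (trans (sym (bit-outside (a q) (a (suc q)) s (a<5 q) (a<5 (suc q)) s<P)) (cong (bit (a q)) (m+[n∸m]≡n L≤r))))
  where
  s = r ∸ 84
  s<P : s < 12
  s<P = +-cancelˡ-< 84 s 12 (subst (_< 96) (sym (m+[n∸m]≡n L≤r)) r<96)
  next : r + q * 84 ≡ s + suc q * 84
  next = trans (cong (_+ q * 84) (sym (m+[n∸m]≡n L≤r))) (ring s (q * 84) 84)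
    where
    ring : ∀ s t l → l + s + t ≡ s + (l + t)
    ring = ℕ.solve-∀

bit-y : ∀ p s → s < 12 → bit (a (p / 84)) (s + p % 84) ≡ y (s + p)
bit-y p s s<P = trans (sym (y-block (p / 84) (s + p % 84) bound))
  (cong y (trans (+-assoc s (p % 84) (p / 84 * 84)) (cong (λ t → s + t) (sym (m≡m%n+[m/n]*n p 84)))))
  where
  bound : s + p % 84 < 96
  bound = subst (s + p % 84 <_) refl (+-mono-<-≤ s<P (<⇒≤ (m%n<n p 84)))

-- The weights vanish on 100, 101 and 110: in a closed walk on pairs of letters
-- the numbers of occurrences of the five other factors determine these three.
weights : List (List ℤ)
weights = 
  (+ 1599 ∷ + 843 ∷ -[1+ 77 ] ∷ -[1+ 2006 ] ∷ + 0 ∷ + 0 ∷ + 0 ∷ + 1599 ∷ []) ∷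
  (+ 1336 ∷ -[1+ 1939 ] ∷ + 320 ∷ + 2160 ∷ + 0 ∷ + 0 ∷ + 0 ∷ -[1+ 2611 ] ∷ []) ∷
  (-[1+ 1913 ] ∷ + 102 ∷ + 960 ∷ + 558 ∷ + 0 ∷ + 0 ∷ + 0 ∷ -[1+ 1913 ] ∷ []) ∷
  (-[1+ 1037 ] ∷ + 1986 ∷ -[1+ 815 ] ∷ + 414 ∷ + 0 ∷ + 0 ∷ + 0 ∷ -[1+ 1037 ] ∷ []) ∷
  (+ 158 ∷ -[1+ 849 ] ∷ -[1+ 103 ] ∷ -[1+ 701 ] ∷ + 0 ∷ + 0 ∷ + 0 ∷ + 4106 ∷ []) ∷ []

ω : ℕ → Weighting
ω i x y z = nth 0ℤ (nth [] weights i) (Fin.toℕ x * 4 + Fin.toℕ y * 2 + Fin.toℕ z)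

inner-block : ℕ → ℕ → ℕ → ℤ
inner-block i b r = ω i (bit b r) (bit b (1 + r)) (bit b (2 + r))

-- On the factors 000, 001, 010, 011 and 111, `weights` is 11844 times the inverse of the matrix of
-- their numbers in the five blocks, where factors running over into the next block are included.
inner-sum : ∀ i b → i < 5 → b < 5 → ∑ 84 (inner-block i b) ≡ + 11844 ℤ.* δ i b
inner-sum i b i<5 b<5 = ==-sound (∑ 84 (inner-block i b)) (+ 11844 ℤ.* δ i b)
  (check-letters (λ i b → ∑ 84 (inner-block i b) == + 11844 ℤ.* δ i b) refl i b i<5 b<5)

pair-code : Fin 2 → Fin 2 → ℕ
pair-code x z = Fin.toℕ x * 2 + Fin.toℕ z

-- `label` encodes the two letters at an offset and `label′` those two places later. At the middle
-- cut point they are the end of the first half and the beginning of the second.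
label label′ : ℕ → ℕ → ℕ
label  b r = pair-code (bit b r) (bit b (1 + r))
label′ b r = pair-code (bit b (2 + r)) (bit b (3 + r))

inner-split : ∀ i q r → i < 5 → r ≤ 2 + 84 →
  ∑ (r + q * 84) (factor-weight y (ω i)) ≡ + 11844 ℤ.* V i q ℤ.+ ∑ r (inner-block i (a q))
inner-split i q r i<5 r≤ = ∑-block-offset 84 (2 + 84) (+ 11844) (factor-weight y (ω i)) (inner-block i) i i<5
  factor (m≤n+m 84 2) (λ b b<5 → inner-sum i b i<5 b<5) q r r≤
  where
  factor : ∀ q r → r < 2 + 84 → factor-weight y (ω i) (r + q * 84) ≡ inner-block i (a q) r
  factor q r r< = cong₃ (ω i) (y-block q r (near 0 z≤n)) (y-block q (1 + r) (near 1 (s≤s z≤n)))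
    (y-block q (2 + r) (near 2 (s≤s (s≤s z≤n))))
    where
    cong₃ : ∀ (f : Weighting) {x x′ y y′ z z′} → x ≡ x′ → y ≡ y′ → z ≡ z′ → f x y z ≡ f x′ y′ z′
    cong₃ f refl refl refl = refl
    near : ∀ s → s ≤ 2 → s + r < 96
    near s s≤2 = ≤-trans (s≤s (+-monoˡ-≤ r s≤2)) (≤-trans (+-monoʳ-≤ 2 r<) (m≤m+n (4 + 84) 8))

inner-split-at : ∀ i p s → i < 5 → s ≤ 2 →
  ∑ (s + p) (factor-weight y (ω i)) ≡ + 11844 ℤ.* V i (p / 84) ℤ.+ ∑ (p % 84 + s) (inner-block i (a (p / 84)))
inner-split-at i p s i<5 s≤2 = trans (cong (λ t → ∑ t (factor-weight y (ω i))) position)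
  (inner-split i (p / 84) (p % 84 + s) i<5
    (subst (_≤ 2 + 84) (+-comm s (p % 84)) (+-mono-≤ s≤2 (<⇒≤ (m%n<n p 84)))))
  where
  position : s + p ≡ p % 84 + s + p / 84 * 84
  position = trans (cong (λ t → s + t) (m≡m%n+[m/n]*n p 84)) (ring s (p % 84) (p / 84 * 84))
    where
    ring : ∀ s r t → s + (r + t) ≡ r + s + t
    ring = ℕ.solve-∀

-- The factors of length 3 inside the first half start at the positions i, …, e₂ − 1
-- with e₂ two before the middle: hence the offset 2.
module Inner = Level 84 2 11844 inner-block _<ᵇ_ label label′ (λ c₁ _ c₂′ → c₁ ≡ᵇ c₂′) _≡ᵇ_
  (λ r₁ r₂ → (r₂ + r₂ + 2 + (84 ∸ r₁)) % 84 ∷ [])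

-- The list covers every case left over at the binary level and is closed under parents, up to
-- abelian squares: these are the two checks that follow.
templates : List Template
templates = 
  template 0 1 0 (+ 0 ∷ + 0 ∷ -[1+ 0 ] ∷ + 0 ∷ + 1 ∷ []) ∷
  template 0 1 2 (-[1+ 0 ] ∷ + 1 ∷ + 0 ∷ -[1+ 0 ] ∷ + 1 ∷ []) ∷
  template 0 3 4 (+ 0 ∷ + 0 ∷ + 0 ∷ + 1 ∷ -[1+ 0 ] ∷ []) ∷
  template 1 0 1 (+ 0 ∷ + 0 ∷ + 1 ∷ + 0 ∷ -[1+ 0 ] ∷ []) ∷
  template 1 3 4 (+ 0 ∷ + 0 ∷ + 0 ∷ + 1 ∷ -[1+ 0 ] ∷ []) ∷
  template 2 1 0 (-[1+ 0 ] ∷ + 1 ∷ + 0 ∷ -[1+ 0 ] ∷ + 1 ∷ []) ∷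
  template 3 0 4 (+ 1 ∷ + 0 ∷ + 0 ∷ -[1+ 0 ] ∷ + 0 ∷ []) ∷
  template 3 1 4 (+ 1 ∷ + 0 ∷ -[1+ 0 ] ∷ -[1+ 0 ] ∷ + 1 ∷ []) ∷
  template 4 0 3 (+ 1 ∷ + 0 ∷ + 0 ∷ -[1+ 0 ] ∷ + 0 ∷ []) ∷
  template 4 1 3 (+ 1 ∷ + 0 ∷ -[1+ 0 ] ∷ -[1+ 0 ] ∷ + 1 ∷ []) ∷ []

inner-check : Inner.check templates (λ _ → 0ℤ) ≡ true
inner-check = refl

templates-check : all (refutable templates) templates ≡ true
templates-check = refl

-- Squares with halves of length at least 3

module _ (i n : ℕ) (equivalent : KAbelianEquivalent 3 (segment y i (3 + n)) (segment y (3 + n + i) (3 + n))) where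

  private
    -- A half of length `2 + m` has `m` factors of length 3. The second half starts at `j`; the last
    -- two letters of the halves stand at `e₂` and `e₃`.
    m e₂ j e₃ : ℕ
    m  = suc n
    e₂ = m + i
    j  = 2 + e₂
    e₃ = m + j

  i<e₂ : i < e₂
  i<e₂ = s≤s (m≤n+m i n)

  e₂<e₃ : e₂ < e₃
  e₂<e₃ = ≤-trans (n≤1+n (suc e₂)) (m≤n+m j m)

  order-at : ∀ {u v} → u < v → u / 84 ≡ v / 84 → (u % 84 <ᵇ v % 84) ≡ true
  order-at {u} {v} u<v eq = <ᵇ-complete (offset-< 84 (v / 84)
    (subst₂ _<_ (trans (m≡m%n+[m/n]*n u 84) (cong (λ q → u % 84 + q * 84) eq)) (m≡m%n+[m/n]*n v 84) u<v))

  next : e₃ % 84 ∈ ((e₂ % 84 + e₂ % 84 + 2 + (84 ∸ i % 84)) % 84 ∷ [])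
  next = here (next-candidate 84 2 {i / 84} {e₂ / 84} {e₃ / 84} {i % 84} {e₂ % 84} {e₃ % 84} (m%n<n i 84) (m%n<n e₃ 84)
    (trans (cong₂ _+_ (sym (m≡m%n+[m/n]*n i 84)) (sym (m≡m%n+[m/n]*n e₃ 84)))
      (trans (ring n i) (cong₂ (λ s t → s + (t + 2)) (m≡m%n+[m/n]*n e₂ 84) (m≡m%n+[m/n]*n e₂ 84)))))
    where
    ring : ∀ n i → i + (1 + n + (2 + (1 + n + i))) ≡ (1 + n + i) + ((1 + n + i) + 2)
    ring = ℕ.solve-∀

  prefix-labels : (label (a (i / 84)) (i % 84) ≡ᵇ label′ (a (e₂ / 84)) (e₂ % 84)) ≡ true
  prefix-labels = ≡ᵇ-complete (cong₂ pair-code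
    (trans (bit-y i 0 (s≤s z≤n)) (trans (proj₁ same) (sym (bit-y e₂ 2 (s≤s (s≤s (s≤s z≤n)))))))
    (trans (bit-y i 1 (s≤s (s≤s z≤n))) (trans (proj₂ same) (sym (bit-y e₂ 3 (s≤s (s≤s (s≤s (s≤s z≤n)))))))))
    where
    same : y i ≡ y j × y (1 + i) ≡ y (1 + j)
    same = same-prefix y i j m equivalent

  suffix-labels : (label (a (e₂ / 84)) (e₂ % 84) ≡ᵇ label (a (e₃ / 84)) (e₃ % 84)) ≡ true
  suffix-labels = ≡ᵇ-complete (cong₂ pair-code
    (trans (bit-y e₂ 0 (s≤s z≤n)) (trans (proj₁ same) (sym (bit-y e₃ 0 (s≤s z≤n)))))
    (trans (bit-y e₂ 1 (s≤s (s≤s z≤n))) (trans (proj₂ same) (sym (bit-y e₃ 1 (s≤s (s≤s z≤n)))))))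
    where
    same : y e₂ ≡ y e₃ × y (1 + e₂) ≡ y (1 + e₃)
    same = same-suffix y i j m equivalent

  inner-equation : ∀ l → l < 5 → + 11844 ℤ.* Δ l (i / 84) (e₂ / 84) (e₃ / 84) ≡
    0ℤ ℤ.+ (∑ (e₂ % 84) (inner-block l (a (e₂ / 84))) ℤ.+ ∑ (e₂ % 84 + 2) (inner-block l (a (e₂ / 84))))
      ℤ.- (∑ (i % 84) (inner-block l (a (i / 84))) ℤ.+ ∑ (e₃ % 84) (inner-block l (a (e₃ / 84))))
  inner-equation l l<5 = combine (S i) (S e₂) (S j) (S e₃) (+ 11844) (V l (i / 84)) (V l (e₂ / 84)) (V l (e₃ / 84))
    (∑ (i % 84) (inner-block l (a (i / 84)))) (∑ (e₂ % 84) (inner-block l (a (e₂ / 84))))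
    (∑ (e₂ % 84 + 2) (inner-block l (a (e₂ / 84)))) (∑ (e₃ % 84) (inner-block l (a (e₃ / 84)))) 0ℤ
    (split i) (split e₂) (inner-split-at l e₂ 2 l<5 ≤-refl) (split e₃)
    (trans (same-weight y i j m equivalent (ω l)) (sym (ℤ.+-identityʳ (S e₂ ℤ.+ S j))))
    where
    S : ℕ → ℤ
    S p = ∑ p (factor-weight y (ω l))
    split : ∀ p → S p ≡ + 11844 ℤ.* V l (p / 84) ℤ.+ ∑ (p % 84) (inner-block l (a (p / 84)))
    split p = trans (cong S (m≡m%n+[m/n]*n p 84))
      (inner-split l (p / 84) (p % 84) l<5 (≤-trans (<⇒≤ (m%n<n p 84)) (m≤n+m 84 2)))

  inner-outcome : Outcome templates (i / 84) (e₂ / 84) (e₃ / 84)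
  inner-outcome = Inner.outcome templates (λ _ → 0ℤ) inner-check
    (i / 84) (e₂ / 84) (e₃ / 84) (i % 84) (e₂ % 84) (e₃ % 84)
    (/-monoˡ-≤ 84 (<⇒≤ i<e₂)) (/-monoˡ-≤ 84 (<⇒≤ e₂<e₃)) (m%n<n i 84) (m%n<n e₂ 84) (m%n<n e₃ 84)
    next (order-at i<e₂) (order-at e₂<e₃) prefix-labels suffix-labels inner-equation

impossible : ∀ {q₁ q₂ q₃} → ¬ Outcome templates q₁ q₂ q₃
impossible (inj₁ (u₁ , u₂ , u₃ , square , _)) = no-abelian-square u₃ u₁ u₂ square
impossible {q₁} {q₂} {q₃} (inj₂ (τ , τ∈ , instance′)) = no-instance templates templates-check q₃ τ τ∈ q₁ q₂ instance′

no-long-square : ∀ i n → ¬ KAbelianEquivalent 3 (segment y i (3 + n)) (segment y (3 + n + i) (3 + n))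
no-long-square i n equivalent = impossible (inner-outcome i n equivalent)

-- Short squares and the values of g

-- This excludes 0000 and 1111, the only squares with halves of length 2 that are not in `squares`.
-- Four letters starting in a block are visible through `bit`, so a check on single blocks is
-- enough.
no-fourth-power : ∀ p → y p ≡ y (1 + p) → y p ≡ y (2 + p) → y p ≢ y (3 + p)
no-fourth-power p e₁ e₂ e₃ = contradiction
  (trans (sym (all-upTo {84} (distinct (a (p / 84))) (all-upTo {5} (λ b → all (distinct b) (upTo 84)) refl (a<5 (p / 84)))
    (m%n<n p 84))) (cong not (both (agree 1 (s≤s (s≤s z≤n)) e₁) (both (agree 2 (s≤s (s≤s (s≤s z≤n))) e₂)
      (agree 3 (s≤s (s≤s (s≤s (s≤s z≤n)))) e₃))))) (λ ())
  where
  distinct : ℕ → ℕ → Bool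
  distinct b r = not ((bit b r ≟ᵇ bit b (1 + r)) ∧ (bit b r ≟ᵇ bit b (2 + r)) ∧ (bit b r ≟ᵇ bit b (3 + r)))
  both : ∀ {x z} → x ≡ true → z ≡ true → x ∧ z ≡ true
  both refl refl = refl
  agree : ∀ s → s < 12 → y p ≡ y (s + p) → (bit (a (p / 84)) (p % 84) ≟ᵇ bit (a (p / 84)) (s + p % 84)) ≡ true
  agree s s<P e = ≡ᵇ-complete (cong Fin.toℕ
    (trans (bit-y p 0 (s≤s z≤n)) (trans e (sym (bit-y p s s<P)))))

squares : List Word
squares = (o ∷ o ∷ []) ∷ (ι ∷ ι ∷ []) ∷ (o ∷ ι ∷ o ∷ ι ∷ []) ∷ (ι ∷ o ∷ ι ∷ o ∷ []) ∷ []

classify-1 : ∀ x z → KAbelianEquivalent 3 (x ∷ []) (z ∷ []) → (x ∷ z ∷ []) ∈ squares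
classify-1 o o _ = here refl
classify-1 ι ι _ = there (here refl)
classify-1 o ι e = contradiction (e (o ∷ []) (λ ()) (s≤s z≤n)) (λ ())
classify-1 ι o e = contradiction (e (o ∷ []) (λ ()) (s≤s z≤n)) (λ ())

classify-2 : ∀ x z → x ≢ z → (x ∷ z ∷ x ∷ z ∷ []) ∈ squares
classify-2 o o x≢z = contradiction refl x≢z
classify-2 ι ι x≢z = contradiction refl x≢z
classify-2 o ι _   = there (there (here refl))
classify-2 ι o _   = there (there (there (here refl)))

classify : ∀ i p → p ≢ 0 → KAbelianEquivalent 3 (segment y i p) (segment y (p + i) p) →
  segment y i p ++ segment y (p + i) p ∈ squares
classify i 0 p≢0 e = contradiction refl p≢0
classify i 1 p≢0 e = classify-1 (y (i + 0)) (y (1 + i + 0)) e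
-- A half of length 2 coincides with its prefix of length 2, so equivalent halves are equal.
classify i 2 p≢0 e = subst (_∈ squares) (sym word) (classify-2 (y i) (y (1 + i)) distinct)
  where
  same : y i ≡ y (2 + i) × y (1 + i) ≡ y (3 + i)
  same = same-prefix y i (2 + i) 0 e
  word : segment y i 2 ++ segment y (2 + i) 2 ≡ y i ∷ y (1 + i) ∷ y i ∷ y (1 + i) ∷ []
  word = trans (cong₂ _++_ (segment-2 y i 0) (segment-2 y (2 + i) 0))
    (cong₂ (λ s t → y i ∷ y (1 + i) ∷ s ∷ t ∷ []) (sym (proj₁ same)) (sym (proj₂ same)))
  distinct : y i ≢ y (1 + i)
  distinct e′ = no-fourth-power i e′ (proj₁ same) (trans e′ (proj₂ same))
classify i (suc (suc (suc n))) p≢0 e = contradiction e (no-long-square i n)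

only-squares : ∀ s → KAbelianSquareIn 3 y s → s ∈ squares
only-squares s ((s≢[] , u , v , refl , e) , i , factor) =
  subst (_∈ squares) (sym halves) (classify i (length u) nonempty
    (subst₂ (KAbelianEquivalent 3) (proj₁ parts) v≡ e))
  where
  lengths : length u ≡ length v
  lengths = same-length y e
  parts : u ≡ segment y i (length u) × v ≡ segment y (length u + i) (length v)
  parts = segment-split y u v i (length v)
    (trans factor (cong (segment y i) (length-++ u)))
  v≡ : v ≡ segment y (length u + i) (length u)
  v≡ = trans (proj₂ parts) (cong (segment y (length u + i)) (sym lengths))
  halves : u ++ v ≡ segment y i (length u) ++ segment y (length u + i) (length u)
  halves = cong₂ _++_ (proj₁ parts) v≡
  nonempty : length u ≢ 0
  nonempty l = s≢[] (empty u v l (trans (sym lengths) l))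
    where
    empty : ∀ (u v : Word) → length u ≡ 0 → length v ≡ 0 → u ++ v ≡ []
    empty [] [] _ _ = refl

-- Both halves are literally equal, which works for every `k`. The positions 1, 4, 6 and 5 all lie
-- inside `common`, at the start of the first block.
squares-occur : ∀ k s → s ∈ squares → KAbelianSquareIn k y s
squares-occur k _ (here refl) =
  ((λ ()) , (o ∷ []) , (o ∷ []) , refl , (λ _ _ _ → refl)) , 1 , refl
squares-occur k _ (there (here refl)) =
  ((λ ()) , (ι ∷ []) , (ι ∷ []) , refl , (λ _ _ _ → refl)) , 4 , refl
squares-occur k _ (there (there (here refl))) =
  ((λ ()) , (o ∷ ι ∷ []) , (o ∷ ι ∷ []) , refl , (λ _ _ _ → refl)) , 6 , refl
squares-occur k _ (there (there (there (here refl)))) =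
  ((λ ()) , (ι ∷ o ∷ []) , (ι ∷ o ∷ []) , refl , (λ _ _ _ → refl)) , 5 , refl

weaken : ∀ x {j k s} → j ≤ k → KAbelianSquareIn k x s → KAbelianSquareIn j x s
weaken x j≤k ((s≢[] , u , v , s≡ , e) , factor) =
  (s≢[] , u , v , s≡ , λ w w≢[] le → e w w≢[] (≤-trans le j≤k)) , factor

exactlyFour : ∀ k → 3 ≤ k → HasExactly 4 (KAbelianSquareIn k y)
exactlyFour k 3≤k = squares , refl ,
  (((λ ()) ∷ (λ ()) ∷ (λ ()) ∷ []) ∷ ((λ ()) ∷ (λ ()) ∷ []) ∷ ((λ ()) ∷ []) ∷ [] ∷ []) ,
  λ s → mk⇔ (squares-occur k s) (λ square → only-squares s (weaken y 3≤k square))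

-- The bound from below is transported from 4 down to `k`, the one from above rests on excluding
-- squares already for 3.
g-value : ∀ k → 3 ≤ k → k ≤ 4 → g k ⩵ 4
g-value k 3≤k k≤4 = (y , exactlyFour k 3≤k) , atLeast
  where
  atLeast : ∀ x → HasAtLeast 4 (KAbelianSquareIn k x)
  atLeast x with ws , len , unique , all-square ← atLeastFour x = ws , len , unique , All.map (weaken x k≤4) all-square

mainTheorem7 : (g 3 ⩵ 4) × (g 4 ⩵ 4)
mainTheorem7 = g-value 3 ≤-refl (n≤1+n 3) , g-value 4 (n≤1+n 3) ≤-refl
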